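{- For every skew shape $\lambda/\mu$ and every positive integer $i$, there exists an involution $\Phi_i$ on $\mathrm{SVRPP}(\lambda/\mu)$ such that for all $T$: $\mathrm{ceq}(\Phi_i(T))=\mathrm{ceq}(T)$, $\mathrm{ex}(\Phi_i(T))=\mathrm{ex}(T)$, and $\mathrm{ircont}(\Phi_i(T))$ is obtained from $\mathrm{ircont}(T)$ by exchanging its $i$-th and $(i+1)$-th entries.
   Context: Boxes are $(i,j)$ (row $i$, column $j$); $\lambda/\mu$ is the skew diagram. $\mathrm{SVRPP}(\lambda/\mu)$ is the set of fillings $T$ of $\lambda/\mu$ by nonempty finite sets $T(a,b)$ of positive integers, weakly increasing along rows and down columns, where $A\le B$ means $\max A\le\min B$. $\mathrm{ircont}(T)=(r_1,r_2,\ldots)$, $r_k$ = number of columns containing a box whose set contains $k$; $\mathrm{ceq}(T)=(c_1,c_2,\ldots)$, $c_a$ = number of boxes $(a,b)$ with $(a+1,b)\in\lambda/\mu$ and $\max T(a,b)=\min T(a+1,b)$; $\mathrm{ex}(T)=(e_1,e_2,\ldots)$, $e_a=\sum_{(a,b)\in\lambda/\mu}(|T(a,b)|-1)$. -}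

module Defs where

open import Data.Nat using (ℕ; zero; suc; _+_; _∸_; _≤_; _<_; _⊔_; _⊓_; _≤ᵇ_; _<ᵇ_; _≡ᵇ_)
open import Data.Bool using (Bool; true; false; _∧_; if_then_else_)
open import Data.List using (List; []; _∷_; length; map; foldr; upTo; filterᵇ)
open import Data.Bool.ListAction using (any)
open import Data.Nat.ListAction using (sum)
open import Data.List.Relation.Unary.All using (All)
open import Data.List.Relation.Unary.Linked using (Linked)
open import Data.Product using (Σ; _×_; proj₁)
open import Relation.Binary.PropositionalEquality using (_≡_; _≢_)

nth : {A : Set} → A → List A → ℕ → A
nth d []       _       = d
nth d (x ∷ xs) zero    = x
nth d (x ∷ xs) (suc n) = nth d xs n

range1 : ℕ → List ℕ
range1 n = map suc (upTo n)

-- row a (1-indexed) of a partition given as a list; row 0 = 0, rows beyond length = 0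
row : List ℕ → ℕ → ℕ
row l zero    = 0
row l (suc a) = nth 0 l a

IsPartition : List ℕ → Set
IsPartition l = Linked (λ x y → y ≤ x) l

_⊆ₚ_ : List ℕ → List ℕ → Set
μ ⊆ₚ la = ∀ a → row μ a ≤ row la a

InShape : List ℕ → List ℕ → ℕ → ℕ → Set
InShape la μ a b = row μ a < b × b ≤ row la a

inShapeᵇ : List ℕ → List ℕ → ℕ → ℕ → Bool
inShapeᵇ la μ a b = (row μ a <ᵇ b) ∧ (b ≤ᵇ row la a)

width : List ℕ → ℕ
width la = foldr _⊔_ 0 la

-- A finite nonempty set of positive integers, canonically encoded as a
-- strictly increasing nonempty list of positive integers.
IsPosSet : List ℕ → Set
IsPosSet s = (s ≢ []) × All (λ x → 1 ≤ x) s × Linked _<_ s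

maxL : List ℕ → ℕ
maxL = foldr _⊔_ 0

minL : List ℕ → ℕ
minL []       = 0
minL (x ∷ xs) = foldr _⊓_ x xs

memberᵇ : ℕ → List ℕ → Bool
memberᵇ k s = any (k ≡ᵇ_) s

-- A filling: list of rows; row a (1-indexed) lists the sets in boxes
-- (a, μ_a + 1), …, (a, λ_a) from left to right.
Filling : Set
Filling = List (List (List ℕ))

-- T(a,b) (meaningful only for (a,b) ∈ λ/μ)
entry : List ℕ → Filling → ℕ → ℕ → List ℕ
entry μ F a b = nth [] (nth [] F (a ∸ 1)) (b ∸ suc (row μ a))

record IsSVRPP (la μ : List ℕ) (F : Filling) : Set where
  field
    rows    : length F ≡ length la
    rowLen  : ∀ a → a < length la → length (nth [] F a) ≡ row la (suc a) ∸ row μ (suc a)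
    sets    : ∀ a b → InShape la μ a b → IsPosSet (entry μ F a b)
    rowWeak : ∀ a b b′ → InShape la μ a b → InShape la μ a b′ → b < b′ →
              maxL (entry μ F a b) ≤ minL (entry μ F a b′)
    colWeak : ∀ a a′ b → InShape la μ a b → InShape la μ a′ b → a < a′ →
              maxL (entry μ F a b) ≤ minL (entry μ F a′ b)

SVRPP : List ℕ → List ℕ → Set
SVRPP la μ = Σ Filling (IsSVRPP la μ)

colHasᵇ : List ℕ → List ℕ → Filling → ℕ → ℕ → Bool
colHasᵇ la μ F k b = any (λ a → inShapeᵇ la μ a b ∧ memberᵇ k (entry μ F a b)) (range1 (length la))

ircont : List ℕ → List ℕ → Filling → ℕ → ℕ
ircont la μ F k = length (filterᵇ (colHasᵇ la μ F k) (range1 (width la)))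

ceq : List ℕ → List ℕ → Filling → ℕ → ℕ
ceq la μ F a = length (filterᵇ
  (λ b → inShapeᵇ la μ a b ∧ inShapeᵇ la μ (suc a) b
         ∧ (maxL (entry μ F a b) ≡ᵇ minL (entry μ F (suc a) b)))
  (range1 (width la)))

ex : List ℕ → List ℕ → Filling → ℕ → ℕ
ex la μ F a = sum (map (λ b → if inShapeᵇ la μ a b then length (entry μ F a b) ∸ 1 else 0)
                      (range1 (width la)))

swapIdx : ℕ → ℕ → ℕ
swapIdx i k = if k ≡ᵇ i then suc i else (if k ≡ᵇ suc i then i else k)

{-# OPTIONS --safe #-}
module Submission where

-- Only the elements i and i+1 of the boxes matter. A column containing them is of one of three kinds: it contains
-- i alone (1), i+1 alone (2), or both (M), in which case i stops and i+1 starts at some place s of the column.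
-- As for the Bender–Knuth involutions of Galashin–Grinberg–Liu, exchange 1 and 2 and then repair the rows: whenever
-- adjacent columns read 2 1, M 1 or 2 M and clash, exchange their types (an M carries its place s along).
-- Repairing permutes the types, hence preserves the number of M's at each place s; this number determines ceq and ex,
-- because replacing i by i+1 in a 1-column changes neither sizes nor vertical equalities.
-- Repairing terminates, and it is confluent because its only critical pair 2 M 1 resolves to 1 M 2 both ways.
-- The map is an involution because exchanging 1 and 2 reverses every repair step, so that the types of T are
-- the normal form reached from the image of T after exchanging 1 and 2 again.

open import Defs
open import Data.Nat using (ℕ; zero; suc; _+_; _*_; _∸_; _≤_; _<_; z≤n; s≤s; _≡ᵇ_; _<?_; _≤?_; _≟_; _⊔_; _⊓_)
open import Data.Nat.Properties
open import Algebra.Properties.CommutativeSemigroup +-commutativeSemigroup using (x∙yz≈y∙xz; interchange)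
open import Data.Nat.Induction using (<-wellFounded)
open import Data.Nat.ListAction using (sum)
open import Data.Nat.ListAction.Properties using (sum-↭)
open import Data.Bool using (Bool; true; false; T; _∧_; if_then_else_)
open import Data.Bool.Properties using (T-∧)
open import Data.Empty using (⊥; ⊥-elim)
open import Data.Unit using (⊤; tt)
open import Data.List using (List; []; _∷_; _++_; length; map; foldr; upTo; applyUpTo; filter; filterᵇ)
open import Data.List.Properties using (length-++; length-applyUpTo; length-map; map-upTo; map-applyUpTo)
open import Data.List.Properties using (map-∘; map-cong; map-cong-local; map-id)
open import Data.List.Membership.Propositional using (_∈_)
open import Data.List.Membership.Propositional.Properties
open import Data.List.Relation.Unary.All as All using (All; []; _∷_)
open import Data.List.Relation.Unary.Any as Any using (Any; here; there)
open import Data.List.Relation.Unary.Any.Properties using (any⁺; any⁻)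
open import Data.List.Relation.Unary.AllPairs as AP using (AllPairs; []; _∷_)
import Data.List.Relation.Unary.AllPairs.Properties as AllPairs
open import Data.List.Relation.Unary.Linked.Properties using (Linked⇒AllPairs; AllPairs⇒Linked)
open import Data.List.Relation.Binary.Permutation.Propositional as Perm using (_↭_)
import Data.List.Relation.Binary.Permutation.Propositional.Properties as Perm
open import Data.Product using (Σ; ∃; _×_; _,_; proj₁; proj₂)
open import Data.Sum using (_⊎_; inj₁; inj₂)
open import Function using (_∘_)
open import Function.Bundles using (Equivalence)
open import Induction.WellFounded using (Acc; acc)
open import Relation.Binary.Construct.Closure.ReflexiveTransitive as Star using (Star; ε; _◅_; _◅◅_)
open import Relation.Binary.Definitions using (tri<; tri≈; tri>)
open import Relation.Binary.PropositionalEquality using (_≡_; _≢_; refl; sym; trans; cong; cong₂; subst; subst₂; module ≡-Reasoning)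
open import Relation.Nullary using (¬_; Dec; yes; no; does; contradiction)
open import Relation.Nullary.Decidable using (_×-dec_; _⊎-dec_; map′; dec-true; dec-false)

-- The boxes meeting {i , i+1} form a convex set that no repair changes: a box weakly south-east of
-- one of them and weakly north-west of another is one of them too. Convexity is why local repairs
-- suffice. A clash in a single row between adjacent columns spreads to the rows where an M stops
-- and starts, so that the M fits into the column it is carried to; and along a row, a clash between
-- distant columns produces one between adjacent columns. There is no repair for two adjacent M's.
-- They never clash because of an invariant: every M has its last i strictly above the first i+1 of
-- any M to its left. For `ceq` the bookkeeping is a conservation law: for two vertically adjacent
-- boxes, the equality there and the break of an M there add up to a number read off the original
-- filling, so only the breaks need to be counted.

infix 1 _⟷_
_⟷_ : Set → Set → Set
A ⟷ B = (A → B) × (B → A)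

T-ext : ∀ {x y} → (T x ⟷ T y) → x ≡ y
T-ext {false} {false} _       = refl
T-ext {false} {true}  (_ , g) = ⊥-elim (g tt)
T-ext {true}  {false} (f , _) = ⊥-elim (f tt)
T-ext {true}  {true}  _       = refl

ind : Bool → ℕ
ind false = 0
ind true  = 1

ind-T : ∀ {x} → T x → ind x ≡ 1
ind-T {true} _ = refl

ind-¬T : ∀ {x} → ¬ T x → ind x ≡ 0
ind-¬T {false} _ = refl
ind-¬T {true}  n = ⊥-elim (n tt)

if-yes : {A B : Set} (d : Dec A) {x y : B} → A → (if does d then x else y) ≡ x
if-yes d a = cong (if_then _ else _) (dec-true d a)

if-no : {A B : Set} (d : Dec A) {x y : B} → ¬ A → (if does d then x else y) ≡ y
if-no d ¬a = cong (if_then _ else _) (dec-false d ¬a)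

length-filterᵇ : {A : Set} (p : A → Bool) (xs : List A) → length (filterᵇ p xs) ≡ sum (map (ind ∘ p) xs)
length-filterᵇ p [] = refl
length-filterᵇ p (x ∷ xs) with p x
... | true  = cong suc (length-filterᵇ p xs)
... | false = length-filterᵇ p xs

sum-map-+ : {A : Set} (f g : A → ℕ) (xs : List A) → sum (map (λ x → f x + g x) xs) ≡ sum (map f xs) + sum (map g xs)
sum-map-+ f g [] = refl
sum-map-+ f g (x ∷ xs) = trans (cong (f x + g x +_) (sum-map-+ f g xs)) (interchange (f x) (g x) _ _)

nth-applyUpTo : {A : Set} {d : A} (f : ℕ → A) {n m : ℕ} → m < n → nth d (applyUpTo f n) m ≡ f m
nth-applyUpTo f {m = zero}  (s≤s _) = refl
nth-applyUpTo f {m = suc m} (s≤s p) = nth-applyUpTo (f ∘ suc) p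

applyUpTo-nth : {A : Set} (d : A) (xs : List A) → applyUpTo (nth d xs) (length xs) ≡ xs
applyUpTo-nth d []       = refl
applyUpTo-nth d (x ∷ xs) = cong (x ∷_) (applyUpTo-nth d xs)

nth-ext : {A : Set} (d : A) {xs ys : List A} → length xs ≡ length ys →
          (∀ n → n < length xs → nth d xs n ≡ nth d ys n) → xs ≡ ys
nth-ext d {[]}     {[]}     _ _ = refl
nth-ext d {x ∷ xs} {y ∷ ys} l e =
  cong₂ _∷_ (e 0 (s≤s z≤n)) (nth-ext d (suc-injective l) (λ n p → e (suc n) (s≤s p)))

∈-range1⁺ : ∀ {a n} → 1 ≤ a → a ≤ n → a ∈ range1 n
∈-range1⁺ {suc a} _ p = ∈-map⁺ suc (∈-upTo⁺ p)

∈-range1⁻ : ∀ {a n} → a ∈ range1 n → 1 ≤ a × a ≤ n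
∈-range1⁻ p with ∈-map⁻ suc p
... | _ , q , refl = s≤s z≤n , ∈-upTo⁻ q

map-range1 : {A : Set} (f : ℕ → A) (n : ℕ) → map f (range1 n) ≡ applyUpTo (f ∘ suc) n
map-range1 f n = trans (sym (map-∘ (upTo n))) (map-upTo (f ∘ suc) n)

sum-range1-cong : {f g : ℕ → ℕ} (n : ℕ) → (∀ {b} → 1 ≤ b → f b ≡ g b) → sum (map f (range1 n)) ≡ sum (map g (range1 n))
sum-range1-cong n e = cong sum (map-cong-local {xs = range1 n} (All.tabulate (λ p → e (proj₁ (∈-range1⁻ {n = n} p)))))

sum-range1-nth : {A : Set} (d : A) (f : A → ℕ) (xs : List A) →
                 sum (map (λ b → f (nth d xs (b ∸ 1))) (range1 (length xs))) ≡ sum (map f xs)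
sum-range1-nth d f xs = cong sum (begin
  map (λ b → f (nth d xs (b ∸ 1))) (range1 (length xs))  ≡⟨ map-range1 _ (length xs) ⟩
  applyUpTo (f ∘ nth d xs) (length xs)                   ≡⟨ sym (map-applyUpTo (nth d xs) f (length xs)) ⟩
  map f (applyUpTo (nth d xs) (length xs))               ≡⟨ cong (map f) (applyUpTo-nth d xs) ⟩
  map f xs                                               ∎)
  where open ≡-Reasoning

-- Extremal elements of bounded decidable predicates

greatest : {P : ℕ → Set} → (∀ a → Dec (P a)) → ∀ n → (∀ a → P a → a < n) →
           (∃ λ p → P p × (∀ a → P a → a ≤ p)) ⊎ (∀ a → ¬ P a)
greatest P? zero    bd = inj₂ (λ a p → n≮0 (bd a p))
greatest P? (suc n) bd with P? n
... | yes pn = inj₁ (n , pn , λ a p → ≤-pred (bd a p))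
... | no ¬pn = greatest P? n (λ a p → ≤∧≢⇒< (≤-pred (bd a p)) (λ { refl → ¬pn p }))

least-below : {P : ℕ → Set} → (∀ a → Dec (P a)) → ∀ n →
              (∃ λ q → P q × (∀ a → P a → q ≤ a)) ⊎ (∀ a → P a → n ≤ a)
least-below P? zero = inj₂ (λ _ _ → z≤n)
least-below P? (suc n) with least-below P? n
... | inj₁ r = inj₁ r
... | inj₂ r with P? n
...   | yes pn = inj₁ (n , pn , r)
...   | no ¬pn = inj₂ (λ a p → ≤∧≢⇒< (r a p) (λ { refl → ¬pn p }))

least : {P : ℕ → Set} → (∀ a → Dec (P a)) → ∀ n → (∀ a → P a → a < n) →
        (∃ λ q → P q × (∀ a → P a → q ≤ a)) ⊎ (∀ a → ¬ P a)
least P? n bd with least-below P? n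
... | inj₁ r = inj₁ r
... | inj₂ r = inj₂ (λ a p → <⇒≱ (bd a p) (r a p))

bounded-∃? : {P : ℕ → Set} → (∀ a → Dec (P a)) → ∀ n → (∀ a → P a → a < n) → Dec (∃ P)
bounded-∃? P? n bd with greatest P? n bd
... | inj₁ (a , p , _) = yes (a , p)
... | inj₂ none        = no (λ { (a , p) → none a p })

-- Finite sets of naturals as increasing lists

sorted-ext : {xs ys : List ℕ} → AllPairs _<_ xs → AllPairs _<_ ys →
             (∀ k → k ∈ xs ⟷ k ∈ ys) → xs ≡ ys
sorted-ext {[]}     {[]}     _ _ _ = refl
sorted-ext {[]}     {y ∷ ys} _ _ e with proj₂ (e y) (here refl)
... | ()
sorted-ext {x ∷ xs} {[]}     _ _ e with proj₁ (e x) (here refl)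
... | ()
sorted-ext {x ∷ xs} {y ∷ ys} (px ∷ sx) (py ∷ sy) e = cong₂ _∷_ x≡y (sorted-ext sx sy tails)
  where
  x≡y : x ≡ y
  x≡y with proj₁ (e x) (here refl) | proj₂ (e y) (here refl)
  ... | here q  | _       = q
  ... | there _ | here q  = sym q
  ... | there p | there q = contradiction (All.lookup px q) (<-asym (All.lookup py p))
  tails : ∀ k → k ∈ xs ⟷ k ∈ ys
  tails k = to , from
    where
    to : k ∈ xs → k ∈ ys
    to p with proj₁ (e k) (there p)
    ... | here refl = contradiction (subst (_< k) x≡y (All.lookup px p)) (<-irrefl refl)
    ... | there q   = q
    from : k ∈ ys → k ∈ xs
    from p with proj₂ (e k) (there p)
    ... | here refl = contradiction (subst (_< k) (sym x≡y) (All.lookup py p)) (<-irrefl refl)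
    ... | there q   = q

T-memberᵇ : ∀ k s → T (memberᵇ k s) ⟷ k ∈ s
T-memberᵇ k s = (λ t → Any.map (≡ᵇ⇒≡ k _) (any⁻ (k ≡ᵇ_) s t)) , (λ m → any⁺ (k ≡ᵇ_) (Any.map (≡⇒≡ᵇ k _) m))

∈⇒≤maxL : ∀ {x s} → x ∈ s → x ≤ maxL s
∈⇒≤maxL {s = y ∷ s} (here refl) = m≤m⊔n y (maxL s)
∈⇒≤maxL {s = y ∷ s} (there p)   = ≤-trans (∈⇒≤maxL p) (m≤n⊔m y (maxL s))

∈⇒minL≤ : ∀ {x s} → x ∈ s → minL s ≤ x
∈⇒minL≤ {x} {y ∷ s} (here refl) = base s
  where
  base : ∀ s → foldr _⊓_ x s ≤ x
  base []      = ≤-refl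
  base (z ∷ s) = ≤-trans (m⊓n≤n z (foldr _⊓_ x s)) (base s)
∈⇒minL≤ {x} {y ∷ s} (there p) = step p
  where
  step : ∀ {s} → x ∈ s → foldr _⊓_ y s ≤ x
  step {z ∷ s} (here refl) = m⊓n≤m z (foldr _⊓_ y s)
  step {z ∷ s} (there p)   = ≤-trans (m⊓n≤n z (foldr _⊓_ y s)) (step p)

minL∈ : ∀ {s} → s ≢ [] → minL s ∈ s
minL∈ {[]} n = contradiction refl n
minL∈ {x ∷ s} _ with foldr-selective ⊓-sel x s
... | inj₁ e = here e
... | inj₂ p = there p

maxL∈ : ∀ {s} → s ≢ [] → maxL s ∈ s
maxL∈ {[]} n = contradiction refl n
maxL∈ {x ∷ s} _ with foldr-selective ⊔-sel 0 (x ∷ s)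
-- The fold starts from the default 0. If it returns this default, the head, being at most the
-- maximum, is itself 0 and attains it.
... | inj₁ e = subst (_∈ x ∷ s) (trans x≡0 (sym e)) (here refl)
  where
  x≡0 : x ≡ 0
  x≡0 = n≤0⇒n≡0 (subst (x ≤_) e (∈⇒≤maxL {s = x ∷ s} (here refl)))
... | inj₂ p = p

-- Rewriting of sequences of column types

-- none, one, two: the column contains neither i nor i+1, only i, only i+1;
-- mix p q: i occurs down to row p and i+1 from row q on, so q is p or p+1.
data Col : Set where
  none one two : Col
  mix : (p q : ℕ) → Col

flip : Col → Col
flip none      = none
flip one       = two
flip two       = one
flip (mix p q) = mix p q

flip-involutive : ∀ x → flip (flip x) ≡ x
flip-involutive none      = refl
flip-involutive one       = refl
flip-involutive two       = refl
flip-involutive (mix p q) = refl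

-- A row `a` with i+1 in the left column and i in the right one would satisfy `q ≤ a ≤ p′`. The
-- condition is imposed on all pairs of columns, because repairs can bring distant mixes next to
-- each other.
Descending : Col → Col → Set
Descending x y = ∀ {p q p′ q′} → x ≡ mix p q → y ≡ mix p′ q′ → p′ < q

weight : Col → ℕ
weight none      = 0
weight one       = 0
weight (mix p q) = 1
weight two       = 2

-- A type counts its weight once for every column to its right. Since a redex has its heavier type
-- on the left, exchanging the pair loses exactly the difference of the two weights.
measure : List Col → ℕ
measure []       = 0
measure (x ∷ xs) = weight x * length xs + measure xs

-- R a b says that box (a , b) contains i or i+1; a redex is a violation of
-- weak increase between columns b and b+1, repaired by exchanging their types.
module Rewriting (R : ℕ → ℕ → Set) where

  Both : ℕ → ℕ → Set
  Both b a = R a b × R a (suc b)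

  -- Asking for both rows `p` and `q` in both columns, instead of one clashing row, ensures that the
  -- mix fits into its new column. A clash in one row yields both by convexity, see `conflict`.
  data Redex (b : ℕ) : Col → Col → Set where
    two-one : ∀ {a} → Both b a → Redex b two one
    mix-one : ∀ {p q} → Both b p → Both b q → Redex b (mix p q) one
    two-mix : ∀ {p q} → Both b p → Both b q → Redex b two (mix p q)

  data Step : ℕ → List Col → List Col → Set where
    here  : ∀ {c x y l} → Redex c x y → Step c (x ∷ y ∷ l) (y ∷ x ∷ l)
    there : ∀ {c x l m} → Step (suc c) l m → Step c (x ∷ l) (x ∷ m)

  Normal : ℕ → List Col → Set
  Normal c l = ∀ {m} → ¬ Step c l m

  -- The same rows serve as witnesses: `flip` makes `mix-one` and `two-mix` mirror images of each
  -- other and `two-one` its own mirror image.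
  flip-redex : ∀ {b x y} → Redex b x y → Redex b (flip y) (flip x)
  flip-redex (two-one r)   = two-one r
  flip-redex (mix-one r s) = two-mix r s
  flip-redex (two-mix r s) = mix-one r s

  flip-step : ∀ {c l m} → Step c l m → Step c (map flip m) (map flip l)
  flip-step (here r)  = here (flip-redex r)
  flip-step (there s) = there (flip-step s)

  flip-steps : ∀ {c l m} → Star (Step c) l m → Star (Step c) (map flip m) (map flip l)
  flip-steps ε        = ε
  flip-steps (s ◅ ss) = flip-steps ss ◅◅ flip-step s ◅ ε

  -- two-mix followed by mix-one, the types 2 M 1, is the only critical pair.
  join-here : ∀ {c x y l m} → Redex c x y → Step (suc c) (y ∷ l) m →
              ∃ λ k → Star (Step c) (y ∷ x ∷ l) k × Star (Step c) (x ∷ m) k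
  join-here (two-mix p q) (here (mix-one p′ q′)) =
    _ , there (here (two-one (proj₂ p , proj₂ p′))) ◅ here (mix-one p q) ◅ ε
      , here (two-one p) ◅ there (here (two-mix p′ q′)) ◅ ε
  join-here r (there s) = _ , there (there s) ◅ ε , here r ◅ ε

  -- When two redexes overlap, the middle type is the lighter one of the first and the heavier one
  -- of the second, which only a mix can be. Redexes at the same place give the same result,
  -- whatever rows witness them.
  locally-confluent : ∀ {c l m n} → Step c l m → Step c l n →
                      ∃ λ k → Star (Step c) m k × Star (Step c) n k
  locally-confluent (here _)  (here _)  = _ , ε , ε
  locally-confluent (here r)  (there s) = join-here r s
  locally-confluent (there s) (here r)  with join-here r s
  ... | k , p , q = k , q , p
  locally-confluent (there s) (there t) with locally-confluent s t
  ... | k , p , q = _ , Star.gmap _ there p , Star.gmap _ there q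

  redex-weight : ∀ {b x y} → Redex b x y → weight y < weight x
  redex-weight (two-one _)   = s≤s z≤n
  redex-weight (mix-one _ _) = s≤s z≤n
  redex-weight (two-mix _ _) = s≤s (s≤s z≤n)

  step-↭ : ∀ {c l m} → Step c l m → l ↭ m
  step-↭ (here {x = x} {y} _) = Perm.swap x y Perm.refl
  step-↭ (there s)            = Perm.prep _ (step-↭ s)

  steps-↭ : ∀ {c l m} → Star (Step c) l m → l ↭ m
  steps-↭ ε        = Perm.refl
  steps-↭ (s ◅ ss) = Perm.trans (step-↭ s) (steps-↭ ss)

  step-decreases : ∀ {c l m} → Step c l m → measure m < measure l
  step-decreases (here {x = x} {y} {l} r) = begin-strict
    weight y * suc n + (weight x * n + M)           ≡⟨ cong (_+ (weight x * n + M)) (*-suc (weight y) n) ⟩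
    (weight y + weight y * n) + (weight x * n + M)  <⟨ +-monoˡ-< _ (+-monoˡ-< (weight y * n) (redex-weight r)) ⟩
    (weight x + weight y * n) + (weight x * n + M)  ≡⟨ +-assoc (weight x) _ _ ⟩
    weight x + (weight y * n + (weight x * n + M))  ≡⟨ cong (weight x +_) (x∙yz≈y∙xz (weight y * n) (weight x * n) M) ⟩
    weight x + (weight x * n + (weight y * n + M))  ≡⟨ sym (+-assoc (weight x) _ _) ⟩
    (weight x + weight x * n) + (weight y * n + M)  ≡⟨ cong (_+ (weight y * n + M)) (sym (*-suc (weight x) n)) ⟩
    weight x * suc n + (weight y * n + M)           ∎
    where
    open ≤-Reasoning
    n = length l
    M = measure l
  step-decreases (there {x = x} {l} {m} s) =
    subst (λ n → weight x * n + measure m < weight x * length l + measure l)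
          (Perm.↭-length (step-↭ s)) (+-monoʳ-< (weight x * length l) (step-decreases s))

  step⇒redex : ∀ {c l m} → Step c l m → ∃ λ n → Redex (c + n) (nth none l n) (nth none l (suc n))
  step⇒redex {c} (here {x = x} {y} r) = 0 , subst (λ k → Redex k x y) (sym (+-identityʳ c)) r
  step⇒redex (there {c} {x} {l} s) with step⇒redex s
  ... | n , r = suc n , subst (λ k → Redex k (nth none l n) (nth none l (suc n))) (sym (+-suc c n)) r

  -- Positions past the end of the list read `none`, which occurs in no redex; this is why `n`
  -- carries no bound.
  redex⇒step : ∀ {c} l n → Redex (c + n) (nth none l n) (nth none l (suc n)) → ∃ (Step c l)
  redex⇒step []          zero    ()
  redex⇒step []          (suc n) ()
  redex⇒step {c} (x ∷ y ∷ l) zero r = _ , here (subst (λ k → Redex k x y) (+-identityʳ c) r)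
  redex⇒step (x ∷ [])    zero    ()
  redex⇒step {c} (x ∷ l) (suc n) r
    with redex⇒step l n (subst (λ k → Redex k (nth none l n) (nth none l (suc n))) (+-suc c n) r)
  ... | _ , s = _ , there s

  -- No redex exchanges two mixes, so they keep their relative order, and every pair that is newly
  -- ordered contains a type which is not a mix.
  descending-step : ∀ {c l m} → Step c l m → AllPairs Descending l → AllPairs Descending m
  descending-step (here r) ((_ ∷ px) ∷ py ∷ ps) = (swapped r ∷ py) ∷ px ∷ ps
    where
    swapped : ∀ {b x y} → Redex b x y → Descending y x
    swapped (two-one _)   ()
    swapped (mix-one _ _) ()
    swapped (two-mix _ _) _ ()
  descending-step (there s) (px ∷ ps) = Perm.All-resp-↭ (step-↭ s) px ∷ descending-step s ps

  module _ (R? : ∀ a b → Dec (R a b)) (Both∃? : ∀ b → Dec (∃ (Both b))) where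

    both? : ∀ b a → Dec (Both b a)
    both? b a = R? a b ×-dec R? a (suc b)

    redex? : ∀ b x y → Dec (Redex b x y)
    redex? b two one = map′ (λ { (_ , r) → two-one r }) (λ { (two-one r) → _ , r }) (Both∃? b)
    redex? b (mix p q) one =
      map′ (λ { (r , s) → mix-one r s }) (λ { (mix-one r s) → r , s }) (both? b p ×-dec both? b q)
    redex? b two (mix p q) =
      map′ (λ { (r , s) → two-mix r s }) (λ { (two-mix r s) → r , s }) (both? b p ×-dec both? b q)
    redex? b none y = no (λ ())
    redex? b one y = no (λ ())
    redex? b two none = no (λ ())
    redex? b two two = no (λ ())
    redex? b (mix p q) none = no (λ ())
    redex? b (mix p q) two = no (λ ())
    redex? b (mix p q) (mix p′ q′) = no (λ ())

    step? : ∀ c l → Dec (∃ (Step c l))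
    step? c [] = no (λ { (_ , ()) })
    step? c (x ∷ []) = no (λ { (_ , there ()) })
    step? c (x ∷ y ∷ l) with redex? c x y | step? (suc c) (y ∷ l)
    ... | yes r | _           = yes (_ , here r)
    ... | no _  | yes (_ , s) = yes (_ , there s)
    ... | no ¬r | no ¬s       = no (λ { (_ , here r) → ¬r r ; (_ , there s) → ¬s (_ , s) })

    normalise-acc : ∀ c l → Acc _<_ (measure l) → ∃ λ m → Star (Step c) l m × Normal c m
    normalise-acc c l (acc rec) with step? c l
    ... | no ¬s = l , ε , λ s → ¬s (_ , s)
    ... | yes (k , s) with normalise-acc c k (rec (step-decreases s))
    ...   | m , ss , n = m , s ◅ ss , n

    normalise : ∀ c l → ∃ λ m → Star (Step c) l m × Normal c m
    normalise c l = normalise-acc c l (<-wellFounded (measure l))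

    -- Newman's lemma, by induction on the measure: the two first steps are joined at `k`, and the
    -- normal form `h` of `k` is reachable from both of their results, which have smaller measure.
    normal-unique-acc : ∀ {c l m n} → Acc _<_ (measure l) → Star (Step c) l m → Normal c m →
                        Star (Step c) l n → Normal c n → m ≡ n
    normal-unique-acc _ ε nm ε nn = refl
    normal-unique-acc _ ε nm (s ◅ _) nn = contradiction s nm
    normal-unique-acc _ (s ◅ _) nm ε nn = contradiction s nn
    normal-unique-acc {c} (acc rec) (s ◅ ss) nm (t ◅ ts) nn with locally-confluent s t
    ... | k , p , q with normalise c k
    ...   | h , r , nh =
      trans (normal-unique-acc (rec (step-decreases s)) ss nm (p ◅◅ r) nh)
            (normal-unique-acc (rec (step-decreases t)) (q ◅◅ r) nh ts nn)

    normal-unique : ∀ {c l m n} → Star (Step c) l m → Normal c m → Star (Step c) l n → Normal c n → m ≡ n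
    normal-unique = normal-unique-acc (<-wellFounded _)

module _ {R S : ℕ → ℕ → Set} (f : ∀ a b → R a b → S a b) where
  private
    module R = Rewriting R
    module S = Rewriting S

  both-map : ∀ {b a} → R.Both b a → S.Both b a
  both-map (r , r′) = f _ _ r , f _ _ r′

  redex-map : ∀ {b x y} → R.Redex b x y → S.Redex b x y
  redex-map (R.two-one r)   = S.two-one (both-map r)
  redex-map (R.mix-one r s) = S.mix-one (both-map r) (both-map s)
  redex-map (R.two-mix r s) = S.two-mix (both-map r) (both-map s)

  -- A filling and its image have the same boxes meeting {i , i+1}, but the two predicates saying so
  -- are only equivalent, so steps have to be transported from one to the other.
  step-map : ∀ {c l m} → R.Step c l m → S.Step c l m
  step-map (R.here r)  = S.here (redex-map r)
  step-map (R.there s) = S.there (step-map s)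

-- Replacing the part of a set inside {i , i+1}

opt : Bool → ℕ → List ℕ
opt false k = []
opt true  k = k ∷ []

∈-opt⁺ : ∀ {x k} → T x → k ∈ opt x k
∈-opt⁺ {true} _ = here refl

∈-opt⁻ : ∀ {x k l} → l ∈ opt x k → T x × l ≡ k
∈-opt⁻ {true} (here e) = tt , e

opt-sorted : ∀ x k → AllPairs _<_ (opt x k)
opt-sorted false k = []
opt-sorted true  k = [] ∷ []

length-opt : ∀ x k → length (opt x k) ≡ ind x
length-opt false k = refl
length-opt true  k = refl

module Put (i : ℕ) where

  lo hi : List ℕ → List ℕ
  lo = filter (_<? i)
  hi = filter (suc i <?_)

  put : List ℕ → Bool → Bool → List ℕ
  put S x y = lo S ++ opt x i ++ opt y (suc i) ++ hi S

  data Position (S : List ℕ) (x y : Bool) (k : ℕ) : Set where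
    low  : k ∈ S → k < i → Position S x y k
    at-i : T x → k ≡ i → Position S x y k
    at-j : T y → k ≡ suc i → Position S x y k
    high : k ∈ S → suc i < k → Position S x y k

  ∈-put⁻ : ∀ {S x y k} → k ∈ put S x y → Position S x y k
  ∈-put⁻ {S} {x} {y} {k} m with ∈-++⁻ (lo S) m
  ... | inj₁ p = let q , l = ∈-filter⁻ (_<? i) p in low q l
  ... | inj₂ m with ∈-++⁻ (opt x i) m
  ...   | inj₁ p = let t , e = ∈-opt⁻ p in at-i t e
  ...   | inj₂ m with ∈-++⁻ (opt y (suc i)) m
  ...     | inj₁ p = let t , e = ∈-opt⁻ p in at-j t e
  ...     | inj₂ p = let q , l = ∈-filter⁻ (suc i <?_) p in high q l

  ∈-put⁺ : ∀ {S x y k} → Position S x y k → k ∈ put S x y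
  ∈-put⁺ {S} (low p l) = ∈-++⁺ˡ (∈-filter⁺ (_<? i) p l)
  ∈-put⁺ {S} {x} (at-i t refl) = ∈-++⁺ʳ (lo S) (∈-++⁺ˡ (∈-opt⁺ t))
  ∈-put⁺ {S} {x} {y} (at-j t refl) = ∈-++⁺ʳ (lo S) (∈-++⁺ʳ (opt x i) (∈-++⁺ˡ (∈-opt⁺ t)))
  ∈-put⁺ {S} {x} {y} (high p l) =
    ∈-++⁺ʳ (lo S) (∈-++⁺ʳ (opt x i) (∈-++⁺ʳ (opt y (suc i)) (∈-filter⁺ (suc i <?_) p l)))

  ∈-put-i : ∀ S x y → i ∈ put S x y ⟷ T x
  ∈-put-i S x y = (λ m → to (∈-put⁻ m)) , (λ t → ∈-put⁺ {S} {x} {y} (at-i t refl))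
    where
    to : Position S x y i → T x
    to (low _ l)  = contradiction l (<-irrefl refl)
    to (at-i t _) = t
    to (at-j _ e) = contradiction (sym e) 1+n≢n
    to (high _ l) = contradiction (n≤1+n i) (<⇒≱ l)

  ∈-put-j : ∀ S x y → suc i ∈ put S x y ⟷ T y
  ∈-put-j S x y = (λ m → to (∈-put⁻ m)) , (λ t → ∈-put⁺ {S} {x} {y} (at-j t refl))
    where
    to : Position S x y (suc i) → T y
    to (low _ l)  = contradiction (n≤1+n i) (<⇒≱ l)
    to (at-i _ e) = contradiction e 1+n≢n
    to (at-j t _) = t
    to (high _ l) = contradiction l (<-irrefl refl)

  ∈-put-other : ∀ S x y {k} → k ≢ i → k ≢ suc i → k ∈ S ⟷ k ∈ put S x y
  ∈-put-other S x y {k} k≢i k≢j = (λ m → ∈-put⁺ (to m)) , (λ m → from (∈-put⁻ m))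
    where
    to : k ∈ S → Position S x y k
    to m with <-cmp k i
    ... | tri< l _ _ = low m l
    ... | tri≈ _ e _ = contradiction e k≢i
    ... | tri> _ _ l = high m (≤∧≢⇒< l (λ e → k≢j (sym e)))
    from : Position S x y k → k ∈ S
    from (low m _)  = m
    from (at-i _ e) = contradiction e k≢i
    from (at-j _ e) = contradiction e k≢j
    from (high m _) = m

  put-sorted : ∀ {S} x y → AllPairs _<_ S → AllPairs _<_ (put S x y)
  put-sorted {S} x y s =
    AllPairs.++⁺ (AllPairs.filter⁺ (_<? i) s)
      (AllPairs.++⁺ (opt-sorted x i)
        (AllPairs.++⁺ (opt-sorted y (suc i)) (AllPairs.filter⁺ (suc i <?_) s)
          (All.tabulate (λ p → All.tabulate (j<hi p))))
        (All.tabulate (λ p → All.tabulate (i<rest p))))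
      (All.tabulate (λ p → All.tabulate (lo<rest p)))
    where
    j<hi : ∀ {k l} → k ∈ opt y (suc i) → l ∈ hi S → k < l
    j<hi p q with ∈-opt⁻ {y} p | ∈-filter⁻ (suc i <?_) {xs = S} q
    ... | _ , refl | _ , l = l
    i<rest : ∀ {k l} → k ∈ opt x i → l ∈ opt y (suc i) ++ hi S → k < l
    i<rest p q with ∈-opt⁻ {x} p | ∈-++⁻ (opt y (suc i)) q
    ... | _ , refl | inj₁ r with ∈-opt⁻ {y} r
    ...   | _ , refl = ≤-refl
    i<rest p q | _ , refl | inj₂ r = <-trans (n<1+n i) (proj₂ (∈-filter⁻ (suc i <?_) {xs = S} r))
    lo<rest : ∀ {k l} → k ∈ lo S → l ∈ opt x i ++ opt y (suc i) ++ hi S → k < l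
    lo<rest p q with ∈-filter⁻ (_<? i) {xs = S} p | ∈-++⁻ (opt x i) q
    ... | _ , k<i | inj₁ r with ∈-opt⁻ {x} r
    ...   | _ , refl = k<i
    lo<rest p q | _ , k<i | inj₂ r with ∈-++⁻ (opt y (suc i)) r
    ... | inj₁ r′ with ∈-opt⁻ {y} r′
    ...   | _ , refl = <-trans k<i (n<1+n i)
    lo<rest p q | _ , k<i | inj₂ r | inj₂ r′ =
      <-trans k<i (<-trans (n<1+n i) (proj₂ (∈-filter⁻ (suc i <?_) {xs = S} r′)))

  outer : List ℕ → ℕ
  outer S = length (lo S) + length (hi S)

  length-put : ∀ S x y → length (put S x y) ≡ outer S + (ind x + ind y)
  length-put S x y = begin
    length (put S x y)                                      ≡⟨ length-++ (lo S) ⟩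
    length (lo S) + length (opt x i ++ opt y (suc i) ++ hi S) ≡⟨ cong (length (lo S) +_) rest ⟩
    length (lo S) + (ind x + (ind y + length (hi S)))       ≡⟨ cong (length (lo S) +_) (sym (+-assoc (ind x) (ind y) _)) ⟩
    length (lo S) + (ind x + ind y + length (hi S))         ≡⟨ cong (length (lo S) +_) (+-comm (ind x + ind y) _) ⟩
    length (lo S) + (length (hi S) + (ind x + ind y))       ≡⟨ sym (+-assoc (length (lo S)) _ _) ⟩
    outer S + (ind x + ind y)                               ∎
    where
    open ≡-Reasoning
    rest : length (opt x i ++ opt y (suc i) ++ hi S) ≡ ind x + (ind y + length (hi S))
    rest = trans (length-++ (opt x i)) (cong₂ _+_ (length-opt x i)
             (trans (length-++ (opt y (suc i))) (cong (_+ length (hi S)) (length-opt y (suc i)))))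

  -- An increasing list is determined by its elements, so `S′` is recovered from `S` and the two
  -- flags telling whether i and i+1 lie in `S′`.
  length-change : ∀ {S S′} → AllPairs _<_ S → AllPairs _<_ S′ →
                  (∀ {k} → k ≢ i → k ≢ suc i → k ∈ S ⟷ k ∈ S′) →
                  length S′ ≡ outer S + (ind (memberᵇ i S′) + ind (memberᵇ (suc i) S′))
  length-change {S} {S′} s s′ e = trans (cong length S′≡put) (length-put S x y)
    where
    x = memberᵇ i S′
    y = memberᵇ (suc i) S′
    agree : ∀ k → k ∈ S′ ⟷ k ∈ put S x y
    agree k with k ≟ i
    ... | yes refl = (λ m → proj₂ (∈-put-i S x y) (proj₂ (T-memberᵇ i S′) m))
                   , (λ m → proj₁ (T-memberᵇ i S′) (proj₁ (∈-put-i S x y) m))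
    ... | no k≢i with k ≟ suc i
    ...   | yes refl = (λ m → proj₂ (∈-put-j S x y) (proj₂ (T-memberᵇ (suc i) S′) m))
                     , (λ m → proj₁ (T-memberᵇ (suc i) S′) (proj₁ (∈-put-j S x y) m))
    ...   | no k≢j = (λ m → proj₁ (∈-put-other S x y k≢i k≢j) (proj₂ (e k≢i k≢j) m))
                   , (λ m → proj₁ (e k≢i k≢j) (proj₂ (∈-put-other S x y k≢i k≢j) m))
    S′≡put : S′ ≡ put S x y
    S′≡put = sorted-ext s′ (put-sorted x y s) agree

-- Skew shapes and their fillings, box by box

All-nth : {A : Set} {P : A → Set} {d : A} {xs : List A} → All P xs → P d → ∀ n → P (nth d xs n)
All-nth []       pd n       = pd
All-nth (p ∷ ps) pd zero    = p
All-nth (p ∷ ps) pd (suc n) = All-nth ps pd n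

AllPairs-nth : {A : Set} {R : A → A → Set} {d : A} {xs : List A} → AllPairs R xs → (∀ x → R x d) →
               ∀ {m n} → m < n → R (nth d xs m) (nth d xs n)
AllPairs-nth {d = d} []       Rd {m}     {n}     _       = Rd d
AllPairs-nth         (p ∷ ps) Rd {zero}  {suc n} _       = All-nth p (Rd _) n
AllPairs-nth         (p ∷ ps) Rd {suc m} {suc n} (s≤s l) = AllPairs-nth ps Rd l

nth-overflow : {A : Set} (d : A) (xs : List A) {n : ℕ} → length xs ≤ n → nth d xs n ≡ d
nth-overflow d []       _       = refl
nth-overflow d (x ∷ xs) (s≤s p) = nth-overflow d xs p

module Shape (la μ : List ℕ) (la-part : IsPartition la) (μ-part : IsPartition μ) where

  -- A record around InShape, from which Agda can infer a and b.
  record In (a b : ℕ) : Set where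
    constructor inside
    field shape : InShape la μ a b
  open In

  T-inShapeᵇ : ∀ a b → T (inShapeᵇ la μ a b) ⟷ In a b
  T-inShapeᵇ a b = (λ t → let p , q = Equivalence.to T-∧ t in inside (<ᵇ⇒< _ _ p , ≤ᵇ⇒≤ _ _ q))
                 , (λ { (inside (p , q)) → Equivalence.from T-∧ (<⇒<ᵇ p , ≤⇒≤ᵇ q) })

  in? : ∀ a b → Dec (In a b)
  in? a b = map′ inside shape ((row μ a <? b) ×-dec (b ≤? row la a))

  -- By convention row 0 has length 0, so row lengths decrease only from row 1 on.
  row-antitone : ∀ {l} → IsPartition l → ∀ {a c} → 1 ≤ a → a ≤ c → row l c ≤ row l a
  row-antitone p {suc a} {suc c} _ (s≤s a≤c) with m≤n⇒m<n∨m≡n a≤c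
  ... | inj₁ a<c  = AllPairs-nth (Linked⇒AllPairs (λ x≥y y≥z → ≤-trans y≥z x≥y) p) (λ _ → z≤n) a<c
  ... | inj₂ refl = ≤-refl

  row≤width : ∀ l a → row l a ≤ width l
  row≤width l zero = z≤n
  row≤width l (suc a) = go l a
    where
    go : ∀ l a → nth 0 l a ≤ width l
    go []      a       = z≤n
    go (x ∷ l) zero    = m≤m⊔n x (width l)
    go (x ∷ l) (suc a) = ≤-trans (go l a) (m≤n⊔m x (width l))

  in-row : ∀ {a b} → In a b → 1 ≤ a
  in-row {zero}  (inside (p , q)) = contradiction q (<⇒≱ p)
  in-row {suc a} _       = s≤s z≤n

  in-row< : ∀ {a b} → In a b → a < suc (length la)
  in-row< {zero}      _       = s≤s z≤n
  in-row< {suc a} {b} (inside (p , q)) with suc a ≤? length la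
  ... | yes l = s≤s l
  ... | no ¬l = contradiction (≤-<-trans z≤n p)
                  (≤⇒≯ (subst (b ≤_) (nth-overflow 0 la (≤-pred (≰⇒> ¬l))) q))

  in-col : ∀ {a b} → In a b → 1 ≤ b
  in-col (inside (p , _)) = ≤-<-trans z≤n p

  in-width : ∀ {a b} → In a b → b ≤ width la
  in-width {a} (inside (_ , q)) = ≤-trans q (row≤width la a)

  -- In row `c` the boundary of `μ` reaches no further right than in row `a`, and that of `la` ends
  -- no further left than in row `a′`.
  between : ∀ {a b a′ b′ c d} → In a b → In a′ b′ → a ≤ c → c ≤ a′ → b ≤ d → d ≤ b′ → In c d
  between i@(inside (p , _)) (inside (_ , q′)) a≤c c≤a′ b≤d d≤b′ = inside (
    ≤-<-trans (row-antitone μ-part (in-row i) a≤c) (<-≤-trans p b≤d) ,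
    ≤-trans d≤b′ (≤-trans q′ (row-antitone la-part (≤-trans (in-row i) a≤c) c≤a′)))

  -- Comparing elements instead of maxima and minima lets order be checked value by value, with i
  -- and i+1 treated apart from the rest.
  record Valid (E : ℕ → ℕ → List ℕ) : Set where
    field
      sets : ∀ {a b} → In a b → IsPosSet (E a b)
      row≤ : ∀ {a b b′ x y} → In a b → In a b′ → b < b′ → x ∈ E a b → y ∈ E a b′ → x ≤ y
      col≤ : ∀ {a a′ b x y} → In a b → In a′ b → a < a′ → x ∈ E a b → y ∈ E a′ b → x ≤ y

    sorted : ∀ {a b} → In a b → AllPairs _<_ (E a b)
    sorted m = Linked⇒AllPairs <-trans (proj₂ (proj₂ (sets m)))

    max∈ : ∀ {a b} → In a b → maxL (E a b) ∈ E a b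
    max∈ m = maxL∈ (proj₁ (sets m))

    min∈ : ∀ {a b} → In a b → minL (E a b) ∈ E a b
    min∈ m = minL∈ (proj₁ (sets m))

    mono : ∀ {a b a′ b′ x y} → In a b → In a′ b′ → a ≤ a′ → b ≤ b′ → ¬ (a ≡ a′ × b ≡ b′) →
           x ∈ E a b → y ∈ E a′ b′ → x ≤ y
    mono m m′ a≤a′ b≤b′ ne x∈ y∈ with m≤n⇒m<n∨m≡n a≤a′ | m≤n⇒m<n∨m≡n b≤b′
    ... | inj₁ a<a′ | inj₂ refl = col≤ m m′ a<a′ x∈ y∈
    ... | inj₂ refl | inj₁ b<b′ = row≤ m m′ b<b′ x∈ y∈
    ... | inj₂ refl | inj₂ refl = contradiction (refl , refl) ne
    -- The comparison passes through the north-east corner `(a , b′)`, which lies in the shape by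
    -- `between`; any of its elements would do.
    ... | inj₁ a<a′ | inj₁ b<b′ = ≤-trans (row≤ m c b<b′ x∈ (min∈ c)) (col≤ c m′ a<a′ (min∈ c) y∈)
      where c = between m m′ ≤-refl a≤a′ b≤b′ ≤-refl

  Valid⇒IsSVRPP : ∀ {F} → length F ≡ length la →
                  (∀ a → a < length la → length (nth [] F a) ≡ row la (suc a) ∸ row μ (suc a)) →
                  Valid (entry μ F) → IsSVRPP la μ F
  Valid⇒IsSVRPP rs rl v = record
    { rows    = rs
    ; rowLen  = rl
    ; sets    = λ a b m → V.sets {a} {b} (inside m)
    ; rowWeak = λ a b b′ m m′ l →
        V.row≤ {a} (inside m) (inside m′) l (V.max∈ {a} {b} (inside m)) (V.min∈ {a} {b′} (inside m′))
    ; colWeak = λ a a′ b m m′ l →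
        V.col≤ {a} {a′} (inside m) (inside m′) l (V.max∈ {a} {b} (inside m)) (V.min∈ {a′} {b} (inside m′))
    }
    where module V = Valid v

  IsSVRPP⇒Valid : ∀ {F} → IsSVRPP la μ F → Valid (entry μ F)
  IsSVRPP⇒Valid v = record
    { sets = λ {a} {b} m → V.sets a b (shape m)
    ; row≤ = λ {a} {b} {b′} m m′ l x∈ y∈ → ≤-trans (∈⇒≤maxL x∈) (≤-trans (V.rowWeak a b b′ (shape m) (shape m′) l) (∈⇒minL≤ y∈))
    ; col≤ = λ {a} {a′} {b} m m′ l x∈ y∈ → ≤-trans (∈⇒≤maxL x∈) (≤-trans (V.colWeak a a′ b (shape m) (shape m′) l) (∈⇒minL≤ y∈))
    }
    where module V = IsSVRPP v

  entry-ext : ∀ {F G} → IsSVRPP la μ F → IsSVRPP la μ G →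
              (∀ a b → In a b → entry μ F a b ≡ entry μ G a b) → F ≡ G
  entry-ext {F} {G} v w e =
    nth-ext [] (trans V.rows (sym W.rows)) λ a a<F →
      let a<la = subst (a <_) V.rows a<F in
      nth-ext [] (trans (V.rowLen a a<la) (sym (W.rowLen a a<la))) λ c c<len →
        let m    = row μ (suc a)
            c<d  = subst (c <_) (V.rowLen a a<la) c<len
            b    = suc (m + c)
            inab = inside (s≤s (m≤m+n m c) ,
                   subst (b ≤_) (m+[n∸m]≡n {m} (<⇒≤ (m∸n≢0⇒n<m (λ z → n≮0 (subst (c <_) z c<d)))))
                         (+-monoʳ-< m c<d))
        in subst (λ k → nth [] (nth [] F a) k ≡ nth [] (nth [] G a) k) (m+n∸m≡n m c) (e (suc a) b inab)
    where
    module V = IsSVRPP v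
    module W = IsSVRPP w

  build-row : (ℕ → ℕ → List ℕ) → ℕ → List (List ℕ)
  build-row E a = applyUpTo (λ c → E (suc a) (suc (row μ (suc a) + c))) (row la (suc a) ∸ row μ (suc a))

  build : (ℕ → ℕ → List ℕ) → Filling
  build E = applyUpTo (build-row E) (length la)

  build-rows : ∀ E → length (build E) ≡ length la
  build-rows E = length-applyUpTo (build-row E) (length la)

  build-rowLen : ∀ E a → a < length la → length (nth [] (build E) a) ≡ row la (suc a) ∸ row μ (suc a)
  build-rowLen E a a<la = trans (cong length (nth-applyUpTo (build-row E) a<la)) (length-applyUpTo _ _)

  entry-build : ∀ E {a b} → In a b → entry μ (build E) a b ≡ E a b
  entry-build E {zero} m = contradiction (in-row m) n≮0
  entry-build E {suc a} {b} m@(inside (p , q)) = begin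
    nth [] (nth [] (build E) a) k        ≡⟨ cong (λ r → nth [] r k) (nth-applyUpTo (build-row E) (≤-pred (in-row< m))) ⟩
    nth [] (build-row E a) k             ≡⟨ nth-applyUpTo _ k<len ⟩
    E (suc a) (suc (row μ (suc a) + k))  ≡⟨ cong (E (suc a)) (m+[n∸m]≡n p) ⟩
    E (suc a) b                          ∎
    where
    open ≡-Reasoning
    k = b ∸ suc (row μ (suc a))
    k<len : k < row la (suc a) ∸ row μ (suc a)
    k<len = +-cancelˡ-< (row μ (suc a)) _ _
              (subst₂ _≤_ (sym (m+[n∸m]≡n p)) (sym (m+[n∸m]≡n (≤-trans (<⇒≤ p) q))) q)

  T-colHasᵇ : ∀ F k b → T (colHasᵇ la μ F k b) ⟷ (∃ λ a → In a b × k ∈ entry μ F a b)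
  T-colHasᵇ F k b = to , from
    where
    to : T (colHasᵇ la μ F k b) → ∃ λ a → In a b × k ∈ entry μ F a b
    to t with Any.satisfied (any⁻ _ (range1 (length la)) t)
    ... | a , s = let p , q = Equivalence.to T-∧ s in
                  a , proj₁ (T-inShapeᵇ a b) p , proj₁ (T-memberᵇ k _) q
    from : (∃ λ a → In a b × k ∈ entry μ F a b) → T (colHasᵇ la μ F k b)
    from (a , m , k∈) = any⁺ _ (Any.map (λ { refl → t }) (∈-range1⁺ (in-row m) (≤-pred (in-row< m))))
      where t = Equivalence.from T-∧ (proj₂ (T-inShapeᵇ a b) m , proj₂ (T-memberᵇ k _) k∈)

  eqᵇ : (ℕ → ℕ → List ℕ) → ℕ → ℕ → Bool
  eqᵇ E a b = inShapeᵇ la μ a b ∧ inShapeᵇ la μ (suc a) b ∧ (maxL (E a b) ≡ᵇ minL (E (suc a) b))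

  Shared : (ℕ → ℕ → List ℕ) → ℕ → ℕ → Set
  Shared E a b = In a b × In (suc a) b × ∃ λ k → k ∈ E a b × k ∈ E (suc a) b

  -- The upper maximum never exceeds the lower minimum, so a common element squeezes the two
  -- together; conversely, equal extremes are a common element.
  T-eqᵇ : ∀ {E} → Valid E → ∀ a b → T (eqᵇ E a b) ⟷ Shared E a b
  T-eqᵇ {E} v a b = to , from
    where
    open Valid v
    to : T (eqᵇ E a b) → Shared E a b
    to t = let p , t′ = Equivalence.to T-∧ t
               q , e  = Equivalence.to T-∧ t′
               m      = proj₁ (T-inShapeᵇ a b) p
               m′     = proj₁ (T-inShapeᵇ (suc a) b) q
           in m , m′ , _ , max∈ m , subst (_∈ E (suc a) b) (sym (≡ᵇ⇒≡ _ _ e)) (min∈ m′)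
    from : Shared E a b → T (eqᵇ E a b)
    from (m , m′ , k , k∈ , k∈′) =
      Equivalence.from T-∧ (proj₂ (T-inShapeᵇ a b) m ,
        Equivalence.from T-∧ (proj₂ (T-inShapeᵇ (suc a) b) m′ ,
          ≡⇒≡ᵇ _ _ (≤-antisym (col≤ m m′ ≤-refl (max∈ m) (min∈ m′)) (≤-trans (∈⇒minL≤ k∈′) (∈⇒≤maxL k∈)))))

-- Types of columns

HasI HasJ : Col → ℕ → Set
HasI none      a = ⊥
HasI one       a = ⊤
HasI two       a = ⊥
HasI (mix p q) a = a ≤ p
HasJ none      a = ⊥
HasJ one       a = ⊥
HasJ two       a = ⊤
HasJ (mix p q) a = q ≤ a

hasI? : ∀ x a → Dec (HasI x a)
hasI? none      a = no λ ()
hasI? one       a = yes tt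
hasI? two       a = no λ ()
hasI? (mix p q) a = a ≤? p

hasJ? : ∀ x a → Dec (HasJ x a)
hasJ? none      a = no λ ()
hasJ? one       a = no λ ()
hasJ? two       a = yes tt
hasJ? (mix p q) a = q ≤? a

isI isJ : Col → Bool
isI one       = true
isI (mix _ _) = true
isI _         = false
isJ two       = true
isJ (mix _ _) = true
isJ _         = false

isI-flip : ∀ x → isI (flip x) ≡ isJ x
isI-flip none      = refl
isI-flip one       = refl
isI-flip two       = refl
isI-flip (mix _ _) = refl

isJ-flip : ∀ x → isJ (flip x) ≡ isI x
isJ-flip none      = refl
isJ-flip one       = refl
isJ-flip two       = refl
isJ-flip (mix _ _) = refl

mix-injective : ∀ {p q p′ q′} → mix p q ≡ mix p′ q′ → p ≡ p′ × q ≡ q′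
mix-injective refl = refl , refl

isMix : ℕ → ℕ → Col → Bool
isMix a c (mix p q) = (p ≡ᵇ a) ∧ (q ≡ᵇ c)
isMix a c _         = false

T-isMix : ∀ {a c} x → T (isMix a c x) → x ≡ mix a c
T-isMix (mix p q) t = let e , f = Equivalence.to T-∧ t in cong₂ mix (≡ᵇ⇒≡ p _ e) (≡ᵇ⇒≡ q _ f)

isMix-refl : ∀ a c → T (isMix a c (mix a c))
isMix-refl a c = Equivalence.from T-∧ (≡⇒≡ᵇ a a refl , ≡⇒≡ᵇ c c refl)

isMix-flip : ∀ a c x → isMix a c (flip x) ≡ isMix a c x
isMix-flip a c none      = refl
isMix-flip a c one       = refl
isMix-flip a c two       = refl
isMix-flip a c (mix _ _) = refl

-- `P` and `Q` stand for the rows that contain i and i+1. Recording the last row of `P` and the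
-- first of `Q` makes the type unique, which later identifies the types of a decoded filling.
data HasType (P Q : ℕ → Set) : Col → Set where
  none : (∀ a → ¬ P a) → (∀ a → ¬ Q a) → HasType P Q none
  one  : ∀ {a} → P a → (∀ a → ¬ Q a) → HasType P Q one
  two  : ∀ {a} → Q a → (∀ a → ¬ P a) → HasType P Q two
  mix  : ∀ {p q} → P p → (∀ a → P a → a ≤ p) → Q q → (∀ a → Q a → q ≤ a) → HasType P Q (mix p q)

hasType-unique : ∀ {P Q x y} → HasType P Q x → HasType P Q y → x ≡ y
hasType-unique (none _ _)      (none _ _)          = refl
hasType-unique (none np _)     (one p _)           = contradiction p (np _)
hasType-unique (none _ nq)     (two q _)           = contradiction q (nq _)
hasType-unique (none np _)     (mix p _ _ _)       = contradiction p (np _)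
hasType-unique (one p _)       (none np _)         = contradiction p (np _)
hasType-unique (one _ _)       (one _ _)           = refl
hasType-unique (one p _)       (two _ np)          = contradiction p (np _)
hasType-unique (one _ nq)      (mix _ _ q _)       = contradiction q (nq _)
hasType-unique (two q _)       (none _ nq)         = contradiction q (nq _)
hasType-unique (two _ np)      (one p _)           = contradiction p (np _)
hasType-unique (two _ _)       (two _ _)           = refl
hasType-unique (two _ np)      (mix p _ _ _)       = contradiction p (np _)
hasType-unique (mix p _ _ _)   (none np _)         = contradiction p (np _)
hasType-unique (mix _ _ q _)   (one _ nq)          = contradiction q (nq _)
hasType-unique (mix p _ _ _)   (two _ np)          = contradiction p (np _)
hasType-unique (mix p gp q lq) (mix p′ gp′ q′ lq′) =
  cong₂ mix (≤-antisym (gp′ _ p) (gp _ p′)) (≤-antisym (lq _ q′) (lq′ _ q))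

hasType-exists : ∀ {P Q} → (∀ a → Dec (P a)) → (∀ a → Dec (Q a)) → ∀ n →
                 (∀ a → P a → a < n) → (∀ a → Q a → a < n) → ∃ (HasType P Q)
hasType-exists P? Q? n bp bq with greatest P? n bp | least Q? n bq
... | inj₁ (_ , p , gp) | inj₁ (_ , q , lq) = _ , mix p gp q lq
... | inj₁ (_ , p , _)  | inj₂ nq           = _ , one p nq
... | inj₂ np           | inj₁ (_ , q , _)  = _ , two q np
... | inj₂ np           | inj₂ nq           = _ , none np nq

hasType-I : ∀ {P Q x} → HasType P Q x → T (isI x) ⟷ ∃ P
hasType-I (none np _)   = (λ ()) , (λ { (_ , p) → np _ p })
hasType-I (one p _)     = (λ _ → _ , p) , _
hasType-I (two _ np)    = (λ ()) , (λ { (_ , p) → np _ p })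
hasType-I (mix p _ _ _) = (λ _ → _ , p) , _

hasType-J : ∀ {P Q x} → HasType P Q x → T (isJ x) ⟷ ∃ Q
hasType-J (none _ nq)   = (λ ()) , (λ { (_ , q) → nq _ q })
hasType-J (one _ nq)    = (λ ()) , (λ { (_ , q) → nq _ q })
hasType-J (two q _)     = (λ _ → _ , q) , _
hasType-J (mix _ _ q _) = (λ _ → _ , q) , _

-- `P` stands for the rows meeting {i , i+1}, and a fitting type can redistribute i and i+1 over
-- them. The bound `q ≤ suc p` leaves no row without either; `p ≤ q` keeps i from occurring below
-- i+1.
data Fits (P : ℕ → Set) : Col → Set where
  none : (∀ a → ¬ P a) → Fits P none
  one  : ∀ {a} → P a → Fits P one
  two  : ∀ {a} → P a → Fits P two
  mix  : ∀ {p q} → P p → P q → p ≤ q → q ≤ suc p → Fits P (mix p q)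

fits-cover : ∀ {P x a} → Fits P x → P a → HasI x a ⊎ HasJ x a
fits-cover (none n) r = contradiction r (n _)
fits-cover (one _)  r = inj₁ tt
fits-cover (two _)  r = inj₂ tt
fits-cover {a = a} (mix {p} _ _ _ q≤p+1) r with a ≤? p
... | yes l = inj₁ l
... | no ¬l = inj₂ (≤-trans q≤p+1 (≰⇒> ¬l))

fits⇒hasType : ∀ {P Q R x} → Fits R x → (∀ a → P a ⟷ (R a × HasI x a)) → (∀ a → Q a ⟷ (R a × HasJ x a)) →
               HasType P Q x
fits⇒hasType (none n) f g = none (λ a p → n a (proj₁ (proj₁ (f a) p))) (λ a q → n a (proj₁ (proj₁ (g a) q)))
fits⇒hasType (one r)  f g = one (proj₂ (f _) (r , tt)) (λ a q → proj₂ (proj₁ (g a) q))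
fits⇒hasType (two r)  f g = two (proj₂ (g _) (r , tt)) (λ a p → proj₂ (proj₁ (f a) p))
fits⇒hasType (mix r s _ _) f g =
  mix (proj₂ (f _) (r , ≤-refl)) (λ a p → proj₂ (proj₁ (f a) p))
      (proj₂ (g _) (s , ≤-refl)) (λ a q → proj₂ (proj₁ (g a) q))

module Fitting (R : ℕ → ℕ → Set) where
  open Rewriting R

  FitsAt : ℕ → Col → Set
  FitsAt b = Fits (λ a → R a b)

  AllFit : ℕ → List Col → Set
  AllFit c l = ∀ n → FitsAt (c + n) (nth none l n)

  flip-fits : ∀ {b x} → FitsAt b x → FitsAt b (flip x)
  flip-fits (none n)      = none n
  flip-fits (one r)       = two r
  flip-fits (two r)       = one r
  flip-fits (mix r s l m) = mix r s l m

  redex-fits : ∀ {b x y} → Redex b x y → FitsAt b x → FitsAt (suc b) y → FitsAt b y × FitsAt (suc b) x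
  redex-fits (two-one (r , r′)) (two _) (one _) = one r , two r′
  redex-fits (mix-one (r , r′) (s , s′)) (mix _ _ l m) (one _) = one r , mix r′ s′ l m
  redex-fits (two-mix (r , r′) (s , s′)) (two _) (mix _ _ l m) = mix r s l m , two r′

  step-fits : ∀ {c l m} → Step c l m → AllFit c l → AllFit c m
  step-fits {c} (here {x = x} {y} r) f = go
    where
    swapped : FitsAt c y × FitsAt (suc c) x
    swapped = redex-fits r (subst (λ k → FitsAt k x) (+-identityʳ c) (f 0))
                           (subst (λ k → FitsAt k y) (trans (+-suc c 0) (cong suc (+-identityʳ c))) (f 1))
    go : AllFit c (y ∷ x ∷ _)
    go zero          = subst (λ k → FitsAt k y) (sym (+-identityʳ c)) (proj₁ swapped)
    go (suc zero)    = subst (λ k → FitsAt k x) (sym (trans (+-suc c 0) (cong suc (+-identityʳ c)))) (proj₂ swapped)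
    go (suc (suc n)) = f (suc (suc n))
  step-fits {c} (there {x = x} {l} {m} s) f = go
    where
    go : AllFit c (x ∷ m)
    go zero    = f 0
    go (suc n) = subst (λ k → FitsAt k (nth none m n)) (sym (+-suc c n))
                   (step-fits s (λ n → subst (λ k → FitsAt k (nth none l n)) (+-suc c n) (f (suc n))) n)

  steps-fit : ∀ {c l m} → Star (Step c) l m → AllFit c l → AllFit c m
  steps-fit ε        f = f
  steps-fit (s ◅ ss) f = steps-fit ss (step-fits s f)

  steps-descending : ∀ {c l m} → Star (Step c) l m → AllPairs Descending l → AllPairs Descending m
  steps-descending ε        d = d
  steps-descending (s ◅ ss) d = steps-descending ss (descending-step s d)

flip-descending : ∀ {l} → AllPairs Descending l → AllPairs Descending (map flip l)
flip-descending d = AllPairs.map⁺ (AP.map flips d)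
  where
  unflip : ∀ {x p q} → flip x ≡ mix p q → x ≡ mix p q
  unflip {x} e = trans (sym (flip-involutive x)) (cong flip e)
  flips : ∀ {x y} → Descending x y → Descending (flip x) (flip y)
  flips d e e′ = d (unflip e) (unflip e′)

nth-map-flip : ∀ l n → nth none (map flip l) n ≡ flip (nth none l n)
nth-map-flip []      n       = refl
nth-map-flip (x ∷ l) zero    = refl
nth-map-flip (x ∷ l) (suc n) = nth-map-flip l n

-- The involution for a fixed i

module BenderKnuth (la μ : List ℕ) (la-part : IsPartition la) (μ-part : IsPartition μ) (i : ℕ) (i-pos : 1 ≤ i) where
  open Shape la μ la-part μ-part
  open Put i

  W : ℕ
  W = width la

  i<i+1≰ : ¬ (suc i ≤ i)
  i<i+1≰ = <⇒≱ ≤-refl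

  data Class (k : ℕ) : Set where
    is-i  : k ≡ i → Class k
    is-j  : k ≡ suc i → Class k
    other : k ≢ i → k ≢ suc i → Class k

  class : ∀ k → Class k
  class k with k ≟ i | k ≟ suc i
  ... | yes e | _     = is-i e
  ... | no _  | yes e = is-j e
  ... | no n  | no n′ = other n n′

  I J Reg : (ℕ → ℕ → List ℕ) → ℕ → ℕ → Set
  I E a b = In a b × i ∈ E a b
  J E a b = In a b × suc i ∈ E a b
  Reg E a b = I E a b ⊎ J E a b

  -- Column types of a valid filling

  module Types (E : ℕ → ℕ → List ℕ) (V : Valid E) where
    open Valid V
    open Rewriting (Reg E)
    open Fitting (Reg E)

    reg-in : ∀ {a b} → Reg E a b → In a b
    reg-in (inj₁ (m , _)) = m
    reg-in (inj₂ (m , _)) = m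

    reg-elem : ∀ {a b} → Reg E a b → ∃ λ z → z ∈ E a b × i ≤ z × z ≤ suc i
    reg-elem (inj₁ (_ , p)) = _ , p , ≤-refl , n≤1+n i
    reg-elem (inj₂ (_ , p)) = _ , p , n≤1+n i , ≤-refl

    below-reg : ∀ {a b x} → Reg E a b → (∀ {z} → z ∈ E a b → x ≤ z) → x ≤ suc i
    below-reg r le = let _ , z∈ , _ , z≤j = reg-elem r in ≤-trans (le z∈) z≤j

    above-reg : ∀ {a b y} → Reg E a b → (∀ {z} → z ∈ E a b → z ≤ y) → i ≤ y
    above-reg r le = let _ , z∈ , i≤z , _ = reg-elem r in ≤-trans i≤z (le z∈)

    elem-reg : ∀ {a b z} → In a b → z ∈ E a b → i ≤ z → z ≤ suc i → Reg E a b
    elem-reg {z = z} m p l u with class z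
    ... | is-i refl  = inj₁ (m , p)
    ... | is-j refl  = inj₂ (m , p)
    ... | other n n′ = contradiction (≤-antisym (≤-pred (≤∧≢⇒< u n′)) l) n

    has? : ∀ k a b → Dec (In a b × k ∈ E a b)
    has? k a b = in? a b ×-dec Any.any? (k ≟_) (E a b)

    i? : ∀ a b → Dec (I E a b)
    i? = has? i

    j? : ∀ a b → Dec (J E a b)
    j? = has? (suc i)

    -- Kept from unfolding so that with-abstractions over reg? a b match.
    abstract
      reg? : ∀ a b → Dec (Reg E a b)
      reg? a b = i? a b ⊎-dec j? a b

    both∃? : ∀ b → Dec (∃ (Both b))
    both∃? b = bounded-∃? (λ a → reg? a b ×-dec reg? a (suc b)) (suc (length la)) (λ a r → in-row< (reg-in (proj₁ r)))

    no-descent : ∀ {a b a′ b′} → J E a b → I E a′ b′ → a ≤ a′ → b ≤ b′ → ¬ (a ≡ a′ × b ≡ b′) → ⊥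
    no-descent (m , p) (m′ , p′) a≤a′ b≤b′ ne = i<i+1≰ (mono m m′ a≤a′ b≤b′ ne p p′)

    -- The elements of a box strictly between the two are at least some element `≥ i` of the first
    -- and at most some element `≤ suc i` of the second. The end boxes are treated apart, since a
    -- box need not be ordered against itself.
    reg-between : ∀ {a b a′ b′ c d} → Reg E a b → Reg E a′ b′ → a ≤ c → c ≤ a′ → b ≤ d → d ≤ b′ → Reg E c d
    reg-between {a} {b} {a′} {b′} {c} {d} r r′ a≤c c≤a′ b≤d d≤b′
      with a ≟ c ×-dec b ≟ d | c ≟ a′ ×-dec d ≟ b′
    ... | yes (refl , refl) | _                 = r
    ... | no _              | yes (refl , refl) = r′
    ... | no ne             | no ne′ =
      let z  , z∈  , i≤z , _   = reg-elem r
          z′ , z′∈ , _   , z′≤ = reg-elem r′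
          m = between (reg-in r) (reg-in r′) a≤c c≤a′ b≤d d≤b′
      in elem-reg m (min∈ m) (≤-trans i≤z (mono (reg-in r) m a≤c b≤d ne z∈ (min∈ m)))
                             (≤-trans (mono m (reg-in r′) c≤a′ d≤b′ ne′ (min∈ m) z′∈) z′≤)

    ColType : ℕ → Col → Set
    ColType b = HasType (λ a → I E a b) (λ a → J E a b)

    colType : ∀ b → ∃ (ColType b)
    colType b = hasType-exists (λ a → i? a b) (λ a → j? a b) (suc (length la))
                  (λ a m → in-row< (proj₁ m)) (λ a m → in-row< (proj₁ m))

    types : List Col
    types = applyUpTo (λ n → proj₁ (colType (suc n))) W

    length-types : length types ≡ W
    length-types = length-applyUpTo _ W

    types-spec : ∀ n → ColType (suc n) (nth none types n)
    types-spec n with n <? W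
    ... | yes n<W = subst (ColType (suc n)) (sym (nth-applyUpTo _ n<W)) (proj₂ (colType (suc n)))
    ... | no n≮W  = subst (ColType (suc n)) (sym (nth-overflow none types W≤n)) (none outside outside)
      where
      W≤n : length types ≤ n
      W≤n = subst (_≤ n) (sym length-types) (≮⇒≥ n≮W)
      outside : ∀ {P : ℕ → Set} a → ¬ (In a (suc n) × P a)
      outside a (m , _) = n≮W (in-width m)

    colType-fits : ∀ {b x} → ColType b x → FitsAt b x
    colType-fits (none n n′) = none λ { a (inj₁ m) → n a m ; a (inj₂ m) → n′ a m }
    colType-fits (one p _)   = one (inj₁ p)
    colType-fits (two q _)   = two (inj₂ q)
    colType-fits {b} (mix {p} {q} mp gp mq lq) = mix (inj₁ mp) (inj₂ mq) p≤q q≤p+1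
      where
      p≤q : p ≤ q
      p≤q with p ≤? q
      ... | yes l = l
      ... | no ¬l = ⊥-elim (no-descent mq mp (<⇒≤ (≰⇒> ¬l)) ≤-refl (λ { (refl , _) → ¬l ≤-refl }))
      q≤p+1 : q ≤ suc p
      q≤p+1 with q ≤? suc p
      ... | yes l = l
      -- Row `suc p` now lies between the two and so meets {i , i+1}: an i there contradicts the
      -- choice of `p`, an i+1 that of `q`.
      ... | no ¬l with reg-between (inj₁ mp) (inj₂ mq) (n≤1+n p) (<⇒≤ (≰⇒> ¬l)) ≤-refl ≤-refl
      ...   | inj₁ m = contradiction (gp _ m) 1+n≰n
      ...   | inj₂ m = contradiction (lq _ m) ¬l

    types-fit : AllFit 1 types
    types-fit n = colType-fits (types-spec n)

    types-descending-at : ∀ {b b′ x y} → b < b′ → ColType b x → ColType b′ y → Descending x y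
    types-descending-at {b} {b′} b<b′ (mix {q = q} _ _ mq _) (mix {p = p} mp _ _ _) refl refl with q ≤? p
    ... | no ¬l = ≰⇒> ¬l
    ... | yes l = ⊥-elim (no-descent mq mp l (<⇒≤ b<b′) (λ { (_ , refl) → <-irrefl refl b<b′ }))

    types-descending : AllPairs Descending types
    types-descending = AllPairs.applyUpTo⁺₁ _ W (λ {m} {n} m<n _ →
      types-descending-at (s≤s m<n) (proj₂ (colType (suc m))) (proj₂ (colType (suc n))))

    -- A redex would put i+1 directly to the left of i: in the witnessing row for `two-one`, in row
    -- `q` for `mix-one`, in row `p` for `two-mix`.
    no-redex : ∀ {b x y} → ColType b x → ColType (suc b) y → ¬ Redex b x y
    no-redex (two _ n) (one _ n′) (two-one (r , r′)) with r | r′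
    ... | inj₁ m | _      = n _ m
    ... | inj₂ _ | inj₂ m = n′ _ m
    ... | inj₂ m | inj₁ m′ = no-descent m m′ ≤-refl (n≤1+n _) (λ { (_ , e) → 1+n≢n (sym e) })
    no-redex (mix _ _ mq _) (one _ n′) (mix-one _ (_ , r)) with r
    ... | inj₁ m = no-descent mq m ≤-refl (n≤1+n _) (λ { (_ , e) → 1+n≢n (sym e) })
    ... | inj₂ m = n′ _ m
    no-redex (two _ n) (mix mp _ _ _) (two-mix (r , _) _) with r
    ... | inj₁ m = n _ m
    ... | inj₂ m = no-descent m mp ≤-refl (n≤1+n _) (λ { (_ , e) → 1+n≢n (sym e) })

    types-normal : Normal 1 types
    types-normal s with step⇒redex s
    ... | n , r = no-redex (types-spec n) (types-spec (suc n)) r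

    -- Columns count from 1 and positions from 0. Truncation sends column 0 to position 0 as well,
    -- hence the hypotheses `1 ≤ b` below.
    at : List Col → ℕ → Col
    at τ b = nth none τ (b ∸ 1)

    -- Rows `p` and `q` lie weakly below the clashing row `a` for `two-mix` and weakly above it for
    -- `mix-one`; either way convexity supplies their boxes in the column that lacks them. Two mixes
    -- clash only against `Descending`.
    conflict : ∀ {a b x y} → FitsAt b x → FitsAt (suc b) y → Descending x y →
               Reg E a b → Reg E a (suc b) → HasJ x a → HasI y a → Redex b x y
    conflict (two _) (one _) _ r r′ _ _ = two-one (r , r′)
    conflict (two _) (mix rp rq p≤q _) _ r r′ _ a≤p =
      two-mix (reg-between r rp a≤p ≤-refl ≤-refl (n≤1+n _) , rp)
              (reg-between r rq (≤-trans a≤p p≤q) ≤-refl ≤-refl (n≤1+n _) , rq)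
    conflict (mix rp rq p≤q _) (one _) _ r r′ q≤a _ =
      mix-one (rp , reg-between rp r′ ≤-refl (≤-trans p≤q q≤a) (n≤1+n _) ≤-refl)
              (rq , reg-between rq r′ ≤-refl q≤a (n≤1+n _) ≤-refl)
    conflict (mix _ _ _ _) (mix _ _ _ _) d r r′ q≤a a≤p =
      ⊥-elim (<⇒≱ (d refl refl) (≤-trans q≤a a≤p))

    -- Type sequences that describe fillings

    record Arrangement (τ : List Col) : Set where
      field
        fit        : AllFit 1 τ
        descending : AllPairs Descending τ
        normal     : Normal 1 τ

      at-fits : ∀ {b} → 1 ≤ b → FitsAt b (at τ b)
      at-fits {suc n} _ = fit n

      no-conflict : ∀ n {a} → Reg E a (suc n) → Reg E a (suc (suc n)) →
                    HasJ (nth none τ n) a → ¬ HasI (nth none τ (suc n)) a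
      no-conflict n r r′ hj hi =
        normal (proj₂ (redex⇒step τ n (conflict (fit n) (fit (suc n))
          (AllPairs-nth descending (λ _ _ ()) (n<1+n n)) r r′ hj hi)))

      -- By convexity all boxes on the way meet {i , i+1}, so each has i or i+1 assigned to it; an i
      -- directly after an i+1 would be a redex.
      J-rightward : ∀ {n a} d → Reg E a (suc n) → Reg E a (suc (d + n)) →
                    HasJ (nth none τ n) a → HasJ (nth none τ (d + n)) a
      J-rightward zero r r′ hj = hj
      J-rightward {n} {a} (suc d) r r′ hj with fits-cover (fit (suc d + n)) r′
      ... | inj₂ hj′ = hj′
      ... | inj₁ hi  = ⊥-elim (no-conflict (d + n) r″ r′ (J-rightward d r r″ hj) hi)
        where r″ = reg-between r r′ ≤-refl ≤-refl (s≤s (m≤n+m n d)) (n≤1+n _)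

      no-row-descent : ∀ {a b b′} → b < b′ → Reg E a b → Reg E a b′ → HasJ (at τ b) a → ¬ HasI (at τ b′) a
      no-row-descent {b = zero}  _    r r′ _  _  = n≮0 (in-col (reg-in r))
      no-row-descent {a} {suc n} b<b′ r r′ hj hi with m≤n⇒∃[o]m+o≡n b<b′
      ... | d , e with trans (cong (suc ∘ suc) (+-comm d n)) e
      ...   | refl = no-conflict (d + n) r″ r′ (J-rightward d r r″ hj) hi
        where r″ = reg-between r r′ ≤-refl ≤-refl (s≤s (m≤n+m n d)) (n≤1+n _)

      no-col-descent : ∀ {a a′ b} → a < a′ → 1 ≤ b → HasJ (at τ b) a → ¬ HasI (at τ b) a′
      no-col-descent {b = b} a<a′ 1≤b hj hi with at τ b | at-fits 1≤b
      ... | mix p q | mix _ _ p≤q _ = <⇒≱ a<a′ (≤-trans hi (≤-trans p≤q hj))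

    -- Specified by membership instead of by a construction, so that the original filling, with its
    -- own types, and the newly built one are both instances; one computation of the statistics then
    -- serves both.
    record Decoded (τ : List Col) (E′ : ℕ → ℕ → List ℕ) : Set where
      field
        sets′  : ∀ {a b} → In a b → IsPosSet (E′ a b)
        others : ∀ {a b k} → In a b → k ≢ i → k ≢ suc i → k ∈ E a b ⟷ k ∈ E′ a b
        i-spec : ∀ {a b} → In a b → i ∈ E′ a b ⟷ (Reg E a b × HasI (at τ b) a)
        j-spec : ∀ {a b} → In a b → suc i ∈ E′ a b ⟷ (Reg E a b × HasJ (at τ b) a)

      sorted′ : ∀ {a b} → In a b → AllPairs _<_ (E′ a b)
      sorted′ m = Linked⇒AllPairs <-trans (proj₂ (proj₂ (sets′ m)))

    types-decoded : Decoded types E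
    types-decoded = record
      { sets′  = sets
      ; others = λ _ _ _ → (λ p → p) , (λ p → p)
      ; i-spec = λ { {a} {zero} m → contradiction (in-col m) n≮0
                 ; {a} {suc n} m → to-i (types-spec n) m , from-i (types-spec n) }
      ; j-spec = λ { {a} {zero} m → contradiction (in-col m) n≮0
                 ; {a} {suc n} m → to-j (types-spec n) m , from-j (types-spec n) }
      }
      where
      to-i : ∀ {a b x} → ColType b x → In a b → i ∈ E a b → Reg E a b × HasI x a
      to-i (none n _)     m p = ⊥-elim (n _ (m , p))
      to-i (one _ _)      m p = inj₁ (m , p) , tt
      to-i (two _ n)      m p = ⊥-elim (n _ (m , p))
      to-i (mix _ gp _ _) m p = inj₁ (m , p) , gp _ (m , p)
      to-j : ∀ {a b x} → ColType b x → In a b → suc i ∈ E a b → Reg E a b × HasJ x a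
      to-j (none _ n)     m p = ⊥-elim (n _ (m , p))
      to-j (one _ n)      m p = ⊥-elim (n _ (m , p))
      to-j (two _ _)      m p = inj₂ (m , p) , tt
      to-j (mix _ _ _ lq) m p = inj₂ (m , p) , lq _ (m , p)
      from-i : ∀ {a b x} → ColType b x → Reg E a b × HasI x a → i ∈ E a b
      from-i _ (inj₁ (_ , p) , _) = p
      from-i (one _ n) (inj₂ m , _) = ⊥-elim (n _ m)
      from-i (mix mp _ _ _) (inj₂ m , a≤p) with m≤n⇒m<n∨m≡n a≤p
      ... | inj₁ a<p  = ⊥-elim (no-descent m mp a≤p ≤-refl (λ { (e , _) → <-irrefl e a<p }))
      ... | inj₂ refl = proj₂ mp
      from-j : ∀ {a b x} → ColType b x → Reg E a b × HasJ x a → suc i ∈ E a b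
      from-j _ (inj₂ (_ , p) , _) = p
      from-j (two _ n) (inj₁ m , _) = ⊥-elim (n _ m)
      from-j (mix _ _ mq _) (inj₁ m , q≤a) with m≤n⇒m<n∨m≡n q≤a
      ... | inj₁ q<a  = ⊥-elim (no-descent mq m q≤a ≤-refl (λ { (e , _) → <-irrefl e q<a }))
      ... | inj₂ refl = proj₂ mq

    types-arranged : Arrangement types
    types-arranged = record { fit = types-fit ; descending = types-descending ; normal = types-normal }

    -- If boxes a and a+1 of a column both meet {i , i+1}, they are equal there unless i stops at a and i+1 starts at a+1.
    eq-const : ℕ → ℕ → ℕ
    eq-const a b = if does (reg? a b ×-dec reg? (suc a) b) then 1 else ind (eqᵇ E a b)

    excess : (ℕ → ℕ → List ℕ) → ℕ → ℕ → ℕ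
    excess F a b = if inShapeᵇ la μ a b then length (F a b) ∸ 1 else 0

    -- A box meeting {i , i+1} contains one of the two, or both exactly when its column is
    -- `mix a a`. The guaranteed one cancels the 1 subtracted in the excess; in other boxes that 1
    -- comes off `outer`.
    excess-const : ℕ → ℕ → ℕ
    excess-const a b = if inShapeᵇ la μ a b then outer (E a b) ∸ (if does (reg? a b) then 0 else 1) else 0

    module Decoding {τ E′} (D : Decoded τ E′) (A : Arrangement τ) where
      open Decoded D
      open Arrangement A

      -- A box given i or i+1 already met {i , i+1} in `E`, so an unchanged element compared with it
      -- there is bounded by `suc i` or by `i`. Being neither of them, it is on the correct side of
      -- both. Only i+1 before i remains to be excluded.
      compare : ∀ {a b a′ b′ x y} → In a b → In a′ b′ →
                (∀ {x y} → x ∈ E a b → y ∈ E a′ b′ → x ≤ y) →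
                (Reg E a b → Reg E a′ b′ → HasJ (at τ b) a → ¬ HasI (at τ b′) a′) →
                x ∈ E′ a b → y ∈ E′ a′ b′ → x ≤ y
      compare {x = x} {y} m m′ le nd x∈ y∈ with class x | class y
      ... | other n₁ n₂ | other n₃ n₄ = le (proj₂ (others m n₁ n₂) x∈) (proj₂ (others m′ n₃ n₄) y∈)
      ... | is-i refl | is-i refl = ≤-refl
      ... | is-i refl | is-j refl = n≤1+n i
      ... | is-j refl | is-j refl = ≤-refl
      ... | is-j refl | is-i refl =
        let r , hj = proj₁ (j-spec m) x∈ ; r′ , hi = proj₁ (i-spec m′) y∈ in ⊥-elim (nd r r′ hj hi)
      ... | other n₁ n₂ | is-i refl =
        ≤-pred (≤∧≢⇒< (below-reg (proj₁ (proj₁ (i-spec m′) y∈)) (le (proj₂ (others m n₁ n₂) x∈))) n₂)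
      ... | other n₁ n₂ | is-j refl = below-reg (proj₁ (proj₁ (j-spec m′) y∈)) (le (proj₂ (others m n₁ n₂) x∈))
      ... | is-i refl | other n₃ n₄ =
        above-reg (proj₁ (proj₁ (i-spec m) x∈)) (λ z∈ → le z∈ (proj₂ (others m′ n₃ n₄) y∈))
      ... | is-j refl | other n₃ n₄ =
        ≤∧≢⇒< (above-reg (proj₁ (proj₁ (j-spec m) x∈)) (λ z∈ → le z∈ (proj₂ (others m′ n₃ n₄) y∈))) (n₃ ∘ sym)

      valid′ : Valid E′
      valid′ = record
        { sets = sets′
        ; row≤ = λ m m′ l → compare m m′ (row≤ m m′ l) (no-row-descent l)
        ; col≤ = λ m m′ l → compare m m′ (col≤ m m′ l) (λ _ _ → no-col-descent l (in-col m))
        }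

      cover : ∀ {a b} → Reg E a b → HasI (at τ b) a ⊎ HasJ (at τ b) a
      cover r = fits-cover (at-fits (in-col (reg-in r))) r

      I-iff : ∀ a b → I E′ a b ⟷ (Reg E a b × HasI (at τ b) a)
      I-iff a b = (λ { (m , p) → proj₁ (i-spec m) p })
                , (λ { (r , h) → reg-in r , proj₂ (i-spec (reg-in r)) (r , h) })

      J-iff : ∀ a b → J E′ a b ⟷ (Reg E a b × HasJ (at τ b) a)
      J-iff a b = (λ { (m , p) → proj₁ (j-spec m) p })
                , (λ { (r , h) → reg-in r , proj₂ (j-spec (reg-in r)) (r , h) })

      Reg-iff : ∀ a b → Reg E a b ⟷ Reg E′ a b
      Reg-iff a b = to , from
        where
        to : Reg E a b → Reg E′ a b
        to r with cover r
        ... | inj₁ h = inj₁ (proj₂ (I-iff a b) (r , h))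
        ... | inj₂ h = inj₂ (proj₂ (J-iff a b) (r , h))
        from : Reg E′ a b → Reg E a b
        from (inj₁ m) = proj₁ (proj₁ (I-iff a b) m)
        from (inj₂ m) = proj₁ (proj₁ (J-iff a b) m)

      decoded-type : ∀ {b} → 1 ≤ b → HasType (λ a → I E′ a b) (λ a → J E′ a b) (at τ b)
      decoded-type {b} 1≤b = fits⇒hasType (at-fits 1≤b) (λ a → I-iff a b) (λ a → J-iff a b)

      mix-reg : ∀ {a c b} → T (isMix a c (at τ b)) → 1 ≤ b → Reg E a b × Reg E c b
      mix-reg {a} {c} {b} t 1≤b with at τ b | T-isMix (at τ b) t | at-fits 1≤b
      ... | _ | refl | mix r r′ _ _ = r , r′

      -- If both boxes meet {i , i+1}, exactly one of the two indicators is 1; otherwise neither i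
      -- nor i+1 can be shared, and other elements have not changed. The right side does not mention
      -- `τ`, so it is common to all decodings.
      eq-balance : ∀ a {b} → 1 ≤ b → ind (eqᵇ E′ a b) + ind (isMix a (suc a) (at τ b)) ≡ eq-const a b
      eq-balance a {b} 1≤b with reg? a b ×-dec reg? (suc a) b
      ... | no ¬r = trans (cong₂ _+_ (cong ind same) (ind-¬T (λ t → ¬r (mix-reg t 1≤b))))
                          (trans (+-identityʳ _) (sym (if-no (reg? a b ×-dec reg? (suc a) b) ¬r)))
        where
        to : Shared E′ a b → Shared E a b
        to (m , m′ , k , p , p′) with class k
        ... | is-i refl  = contradiction (proj₁ (proj₁ (i-spec m) p) , proj₁ (proj₁ (i-spec m′) p′)) ¬r
        ... | is-j refl  = contradiction (proj₁ (proj₁ (j-spec m) p) , proj₁ (proj₁ (j-spec m′) p′)) ¬r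
        ... | other n n′ = m , m′ , k , proj₂ (others m n n′) p , proj₂ (others m′ n n′) p′
        from : Shared E a b → Shared E′ a b
        from (m , m′ , k , p , p′) with class k
        ... | is-i refl  = contradiction (inj₁ (m , p) , inj₁ (m′ , p′)) ¬r
        ... | is-j refl  = contradiction (inj₂ (m , p) , inj₂ (m′ , p′)) ¬r
        ... | other n n′ = m , m′ , k , proj₁ (others m n n′) p , proj₁ (others m′ n n′) p′
        same : eqᵇ E′ a b ≡ eqᵇ E a b
        same = T-ext ((λ t → proj₂ (T-eqᵇ V a b) (to (proj₁ (T-eqᵇ valid′ a b) t)))
                    , (λ t → proj₂ (T-eqᵇ valid′ a b) (from (proj₁ (T-eqᵇ V a b) t))))
      ... | yes (r , r′) = trans (count (at τ b) refl (at-fits 1≤b))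
                             (sym (if-yes (reg? a b ×-dec reg? (suc a) b) (r , r′)))
        where
        m  = reg-in r
        m′ = reg-in r′
        share-i : HasI (at τ b) a → HasI (at τ b) (suc a) → ind (eqᵇ E′ a b) ≡ 1
        share-i h h′ = ind-T (proj₂ (T-eqᵇ valid′ a b)
          (m , m′ , i , proj₂ (i-spec m) (r , h) , proj₂ (i-spec m′) (r′ , h′)))
        share-j : HasJ (at τ b) a → HasJ (at τ b) (suc a) → ind (eqᵇ E′ a b) ≡ 1
        share-j h h′ = ind-T (proj₂ (T-eqᵇ valid′ a b)
          (m , m′ , suc i , proj₂ (j-spec m) (r , h) , proj₂ (j-spec m′) (r′ , h′)))
        unshared : ¬ HasI (at τ b) (suc a) → ¬ HasJ (at τ b) a → ¬ Shared E′ a b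
        unshared ¬hi ¬hj (_ , _ , k , p , p′) with class k
        ... | is-i refl  = ¬hi (proj₂ (proj₁ (i-spec m′) p′))
        ... | is-j refl  = ¬hj (proj₂ (proj₁ (j-spec m) p))
        -- Any shared `k` is caught in {i , i+1}: the lower box has an element `≤ suc i` in `E`, the
        -- upper one an element `≥ i`.
        ... | other n n′ =
          n (≤-antisym (≤-pred (≤∧≢⇒< (below-reg r′ (λ z∈ → col≤ m m′ ≤-refl (proj₂ (others m n n′) p) z∈)) n′))
                       (above-reg r (λ z∈ → col≤ m m′ ≤-refl z∈ (proj₂ (others m′ n n′) p′))))
        has : ∀ {x} (H : Col → ℕ → Set) {c} → at τ b ≡ x → H x c → H (at τ b) c
        has H e h = subst (λ x → H x _) (sym e) h
        count : ∀ x → at τ b ≡ x → FitsAt b x → ind (eqᵇ E′ a b) + ind (isMix a (suc a) x) ≡ 1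
        count _ e (none n) = ⊥-elim (n a r)
        count _ e (one _)  = cong (_+ 0) (share-i (has HasI e tt) (has HasI e tt))
        count _ e (two _)  = cong (_+ 0) (share-j (has HasJ e tt) (has HasJ e tt))
        count (mix p q) e (mix _ _ p≤q q≤p+1) with suc a ≤? p | q ≤? a
        ... | yes l | _ =
          cong₂ _+_ (share-i (has HasI e (<⇒≤ l)) (has HasI e l))
                    (ind-¬T (λ t → 1+n≰n (subst (suc a ≤_) (proj₁ (mix-injective (T-isMix (mix p q) t))) l)))
        ... | no _  | yes l =
          cong₂ _+_ (share-j (has HasJ e l) (has HasJ e (m≤n⇒m≤1+n l)))
                    (ind-¬T (λ t → 1+n≰n (subst (_≤ a) (proj₂ (mix-injective (T-isMix (mix p q) t))) l)))
        ... | no ¬l | no ¬l′ =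
          cong₂ _+_ (ind-¬T (λ t → unshared (λ h → ¬l (subst (λ x → HasI x (suc a)) e h))
                                            (λ h → ¬l′ (subst (λ x → HasJ x a) e h)) (proj₁ (T-eqᵇ valid′ a b) t)))
                    (ind-T (subst T (cong₂ (λ p q → isMix a (suc a) (mix p q)) (sym p≡a) (sym q≡a+1)) (isMix-refl a (suc a))))
          where
          p≤a : p ≤ a
          p≤a = ≤-pred (≰⇒> ¬l)
          a<q : a < q
          a<q = ≰⇒> ¬l′
          p≡a : p ≡ a
          p≡a = ≤-antisym p≤a (≤-pred (≤-trans a<q q≤p+1))
          q≡a+1 : q ≡ suc a
          q≡a+1 = ≤-antisym (≤-trans q≤p+1 (s≤s p≤a)) a<q

      excess-balance : ∀ a {b} → 1 ≤ b → excess E′ a b ≡ excess-const a b + ind (isMix a a (at τ b))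
      excess-balance a {b} 1≤b with inShapeᵇ la μ a b | T-inShapeᵇ a b
      ... | false | _ , out = sym (ind-¬T (λ t → out (reg-in (proj₁ (mix-reg t 1≤b)))))
      ... | true  | to , _ = trans (cong (_∸ 1) (length-change (sorted m) (sorted′ m) (others m))) split
        where
        m = to tt
        x = memberᵇ i (E′ a b)
        y = memberᵇ (suc i) (E′ a b)
        split : outer (E a b) + (ind x + ind y) ∸ 1
                ≡ outer (E a b) ∸ (if does (reg? a b) then 0 else 1) + ind (isMix a a (at τ b))
        split with reg? a b
        ... | no ¬r = begin
          outer (E a b) + (ind x + ind y) ∸ 1  ≡⟨ cong (λ n → outer (E a b) + n ∸ 1) (cong₂ _+_ x≡0 y≡0) ⟩
          outer (E a b) + 0 ∸ 1                ≡⟨ cong (_∸ 1) (+-identityʳ (outer (E a b))) ⟩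
          K                                    ≡⟨ sym (+-identityʳ K) ⟩
          K + 0                                ≡⟨ sym (cong (K +_) (ind-¬T (λ t → ¬r (proj₁ (mix-reg t 1≤b))))) ⟩
          K + ind (isMix a a (at τ b))         ∎
          where
          open ≡-Reasoning
          K = outer (E a b) ∸ 1
          x≡0 : ind x ≡ 0
          x≡0 = ind-¬T (λ t → ¬r (proj₁ (proj₁ (i-spec m) (proj₁ (T-memberᵇ i _) t))))
          y≡0 : ind y ≡ 0
          y≡0 = ind-¬T (λ t → ¬r (proj₁ (proj₁ (j-spec m) (proj₁ (T-memberᵇ (suc i) _) t))))
        ... | yes r = begin
          outer (E a b) + (ind x + ind y) ∸ 1  ≡⟨ cong (λ n → outer (E a b) + n ∸ 1) (count (at τ b) refl (at-fits 1≤b)) ⟩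
          outer (E a b) + suc M ∸ 1            ≡⟨ cong (_∸ 1) (+-suc (outer (E a b)) M) ⟩
          outer (E a b) + M                    ∎
          where
          open ≡-Reasoning
          M = ind (isMix a a (at τ b))
          yes-i : ∀ {z} → at τ b ≡ z → HasI z a → ind x ≡ 1
          yes-i e h = ind-T (proj₂ (T-memberᵇ i _) (proj₂ (i-spec m) (r , subst (λ z → HasI z a) (sym e) h)))
          yes-j : ∀ {z} → at τ b ≡ z → HasJ z a → ind y ≡ 1
          yes-j e h = ind-T (proj₂ (T-memberᵇ (suc i) _) (proj₂ (j-spec m) (r , subst (λ z → HasJ z a) (sym e) h)))
          no-i : ∀ {z} → at τ b ≡ z → ¬ HasI z a → ind x ≡ 0
          no-i e h = ind-¬T (λ t → h (subst (λ z → HasI z a) e (proj₂ (proj₁ (i-spec m) (proj₁ (T-memberᵇ i _) t)))))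
          no-j : ∀ {z} → at τ b ≡ z → ¬ HasJ z a → ind y ≡ 0
          no-j e h = ind-¬T (λ t → h (subst (λ z → HasJ z a) e (proj₂ (proj₁ (j-spec m) (proj₁ (T-memberᵇ (suc i) _) t)))))
          count : ∀ z → at τ b ≡ z → FitsAt b z → ind x + ind y ≡ suc (ind (isMix a a z))
          count _ e (none n) = ⊥-elim (n a r)
          count _ e (one _)  = cong₂ _+_ (yes-i e tt) (no-j e (λ ()))
          count _ e (two _)  = cong₂ _+_ (no-i e (λ ())) (yes-j e tt)
          count (mix p q) e (mix _ _ p≤q q≤p+1) with a ≤? p | q ≤? a
          ... | yes l | yes l′ = trans (cong₂ _+_ (yes-i e l) (yes-j e l′)) (cong suc (sym (ind-T
                  (subst T (cong₂ (λ p q → isMix a a (mix p q))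
                    (≤-antisym l (≤-trans p≤q l′)) (≤-antisym (≤-trans l p≤q) l′)) (isMix-refl a a)))))
          ... | yes l | no ¬l′ = trans (cong₂ _+_ (yes-i e l) (no-j e ¬l′))
                  (cong suc (sym (ind-¬T λ t → ¬l′ (≤-reflexive (proj₂ (mix-injective (T-isMix (mix p q) t)))))))
          ... | no ¬l | yes l′ = trans (cong₂ _+_ (no-i e ¬l) (yes-j e l′))
                  (cong suc (sym (ind-¬T λ t → ¬l (≤-reflexive (sym (proj₁ (mix-injective (T-isMix (mix p q) t))))))))
          ... | no ¬l | no ¬l′ = contradiction (≤-trans q≤p+1 (≰⇒> ¬l)) ¬l′

    -- The statistics as sums over column types

    module Statistics {τ} (F′ : Filling) (D : Decoded τ (entry μ F′)) (A : Arrangement τ) (len : length τ ≡ W) where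
      open Decoded D
      open Decoding D A

      total : (Col → ℕ) → ℕ
      total f = sum (map f τ)

      total≡ : ∀ f → sum (map (λ b → f (at τ b)) (range1 W)) ≡ total f
      total≡ f = subst (λ n → sum (map (λ b → f (at τ b)) (range1 n)) ≡ total f) len (sum-range1-nth none f τ)

      ceq-total : ∀ a → ceq la μ F′ a + total (ind ∘ isMix a (suc a)) ≡ sum (map (eq-const a) (range1 W))
      ceq-total a = begin
        ceq la μ F′ a + total mixed
          ≡⟨ cong₂ _+_ (length-filterᵇ (eqᵇ (entry μ F′) a) (range1 W)) (sym (total≡ mixed)) ⟩
        sum (map (ind ∘ eqᵇ (entry μ F′) a) (range1 W)) + sum (map (λ b → mixed (at τ b)) (range1 W))
          ≡⟨ sym (sum-map-+ _ _ (range1 W)) ⟩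
        sum (map (λ b → ind (eqᵇ (entry μ F′) a b) + mixed (at τ b)) (range1 W))
          ≡⟨ sum-range1-cong W (eq-balance a) ⟩
        sum (map (eq-const a) (range1 W)) ∎
        where
        open ≡-Reasoning
        mixed = ind ∘ isMix a (suc a)

      ex-total : ∀ a → ex la μ F′ a ≡ sum (map (excess-const a) (range1 W)) + total (ind ∘ isMix a a)
      ex-total a = begin
        ex la μ F′ a
          ≡⟨ sum-range1-cong W (excess-balance a) ⟩
        sum (map (λ b → excess-const a b + mixed (at τ b)) (range1 W))
          ≡⟨ sum-map-+ _ _ (range1 W) ⟩
        sum (map (excess-const a) (range1 W)) + sum (map (λ b → mixed (at τ b)) (range1 W))
          ≡⟨ cong (sum (map (excess-const a) (range1 W)) +_) (total≡ mixed) ⟩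
        sum (map (excess-const a) (range1 W)) + total mixed ∎
        where
        open ≡-Reasoning
        mixed = ind ∘ isMix a a

      ircont-total : ∀ k (f : Col → Bool) →
                     (∀ {b} → 1 ≤ b → T (f (at τ b)) ⟷ (∃ λ a → In a b × k ∈ entry μ F′ a b)) →
                     ircont la μ F′ k ≡ total (ind ∘ f)
      ircont-total k f e = begin
        ircont la μ F′ k                                      ≡⟨ length-filterᵇ (colHasᵇ la μ F′ k) (range1 W) ⟩
        sum (map (ind ∘ colHasᵇ la μ F′ k) (range1 W))        ≡⟨ sum-range1-cong W (λ {b} 1≤b → cong ind (same b 1≤b)) ⟩
        sum (map (λ b → ind (f (at τ b))) (range1 W))         ≡⟨ total≡ (ind ∘ f) ⟩
        total (ind ∘ f)                                       ∎
        where
        open ≡-Reasoning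
        same : ∀ b → 1 ≤ b → colHasᵇ la μ F′ k b ≡ f (at τ b)
        same b 1≤b = T-ext ((λ t → proj₂ (e 1≤b) (proj₁ (T-colHasᵇ F′ k b) t))
                          , (λ t → proj₂ (T-colHasᵇ F′ k b) (proj₁ (e 1≤b) t)))

      ircont-i : ircont la μ F′ i ≡ total (ind ∘ isI)
      ircont-i = ircont-total i isI (λ 1≤b → hasType-I (decoded-type 1≤b))

      ircont-j : ircont la μ F′ (suc i) ≡ total (ind ∘ isJ)
      ircont-j = ircont-total (suc i) isJ (λ 1≤b → hasType-J (decoded-type 1≤b))

    newI newJ : List Col → ℕ → ℕ → Bool
    newI τ a b = does (reg? a b ×-dec hasI? (at τ b) a)
    newJ τ a b = does (reg? a b ×-dec hasJ? (at τ b) a)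

    decode : List Col → ℕ → ℕ → List ℕ
    decode τ a b = put (E a b) (newI τ a b) (newJ τ a b)

    decode-decoded : ∀ {τ} → Arrangement τ → Decoded τ (entry μ (build (decode τ)))
    decode-decoded {τ} A = record
      { sets′  = λ m → subst IsPosSet (sym (entry-build (decode τ) m)) (posSet m)
      ; others = λ {a} {b} {k} m n n′ → subst (λ s → k ∈ E a b ⟷ k ∈ s) (sym (entry-build (decode τ) m))
                                          (other∈ a b n n′)
      ; i-spec = λ {a} {b} m → subst (λ s → i ∈ s ⟷ (Reg E a b × HasI (at τ b) a)) (sym (entry-build (decode τ) m)) (i∈ a b)
      ; j-spec = λ {a} {b} m → subst (λ s → suc i ∈ s ⟷ (Reg E a b × HasJ (at τ b) a)) (sym (entry-build (decode τ) m)) (j∈ a b)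
      }
      where
      open Arrangement A
      T-does : ∀ {P : Set} (d : Dec P) → T (does d) ⟷ P
      T-does (yes p) = (λ _ → p) , _
      T-does (no ¬p) = (λ ()) , ¬p
      other∈ : ∀ a b {k} → k ≢ i → k ≢ suc i → k ∈ E a b ⟷ k ∈ decode τ a b
      other∈ a b = ∈-put-other (E a b) (newI τ a b) (newJ τ a b)
      i∈ : ∀ a b → i ∈ decode τ a b ⟷ (Reg E a b × HasI (at τ b) a)
      i∈ a b = (λ p → proj₁ T-newI (proj₁ i∈put p)) , (λ r → proj₂ i∈put (proj₂ T-newI r))
        where
        i∈put  = ∈-put-i (E a b) (newI τ a b) (newJ τ a b)
        T-newI = T-does (reg? a b ×-dec hasI? (at τ b) a)
      j∈ : ∀ a b → suc i ∈ decode τ a b ⟷ (Reg E a b × HasJ (at τ b) a)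
      j∈ a b = (λ p → proj₁ T-newJ (proj₁ j∈put p)) , (λ r → proj₂ j∈put (proj₂ T-newJ r))
        where
        j∈put  = ∈-put-j (E a b) (newI τ a b) (newJ τ a b)
        T-newJ = T-does (reg? a b ×-dec hasJ? (at τ b) a)
      regular : ∀ {a b} → Reg E a b → ∃ λ k → k ∈ decode τ a b
      regular r with fits-cover (at-fits (in-col (reg-in r))) r
      ... | inj₁ h = _ , proj₂ (i∈ _ _) (r , h)
      ... | inj₂ h = _ , proj₂ (j∈ _ _) (r , h)
      inhabited : ∀ {a b} → In a b → ∃ λ k → k ∈ decode τ a b
      inhabited {a} {b} m with class (minL (E a b))
      ... | other n n′ = _ , proj₁ (other∈ a b n n′) (min∈ m)
      ... | is-i e = regular (inj₁ (m , subst (_∈ E a b) e (min∈ m)))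
      ... | is-j e = regular (inj₂ (m , subst (_∈ E a b) e (min∈ m)))
      positive : ∀ {a b k} → In a b → k ∈ decode τ a b → 1 ≤ k
      positive {a} {b} {k} m k∈ with class k
      ... | is-i refl  = i-pos
      ... | is-j refl  = s≤s z≤n
      ... | other n n′ = All.lookup (proj₁ (proj₂ (sets m))) (proj₂ (other∈ a b n n′) k∈)
      posSet : ∀ {a b} → In a b → IsPosSet (decode τ a b)
      posSet {a} {b} m = (λ e → empty (subst (proj₁ (inhabited m) ∈_) e (proj₂ (inhabited m))))
                       , All.tabulate (positive m)
                       , AllPairs⇒Linked (put-sorted (newI τ a b) (newJ τ a b) (sorted m))
        where
        empty : ∀ {k : ℕ} → ¬ (k ∈ [])
        empty ()

    normalised : ∃ λ τ → Star (Step 1) (map flip types) τ × Normal 1 τ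
    normalised = normalise reg? both∃? 1 (map flip types)

    image : List Col
    image = proj₁ normalised

    image-arranged : Arrangement image
    image-arranged = record
      { fit        = steps-fit (proj₁ (proj₂ normalised))
          (λ n → subst (FitsAt (suc n)) (sym (nth-map-flip types n)) (flip-fits (types-fit n)))
      ; descending = steps-descending (proj₁ (proj₂ normalised)) (flip-descending types-descending)
      ; normal     = proj₂ (proj₂ normalised)
      }

    image-↭ : map flip types ↭ image
    image-↭ = steps-↭ (proj₁ (proj₂ normalised))

    length-image : length image ≡ W
    length-image = trans (sym (Perm.↭-length image-↭)) (trans (length-map flip types) length-types)

    total-image : ∀ f g → (∀ x → f (flip x) ≡ g x) → sum (map (ind ∘ f) image) ≡ sum (map (ind ∘ g) types)
    total-image f g e = begin
      sum (map (ind ∘ f) image)             ≡⟨ sym (sum-↭ (Perm.map⁺ (ind ∘ f) image-↭)) ⟩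
      sum (map (ind ∘ f) (map flip types))  ≡⟨ cong sum (sym (map-∘ types)) ⟩
      sum (map (ind ∘ f ∘ flip) types)      ≡⟨ cong sum (map-cong (cong ind ∘ e) types) ⟩
      sum (map (ind ∘ g) types)             ∎
      where open ≡-Reasoning

  -- Applying the map twice

  module Twice {E E″} (V : Valid E) (V″ : Valid E″) (D : Types.Decoded E V (Types.image E V) E″) where
    open Types E V
    open Valid V using (sorted)
    open Rewriting (Reg E) using (Step; flip-steps; normal-unique)
    private module T″ = Types E″ V″
    open Decoding D image-arranged

    types-of-image : T″.types ≡ image
    types-of-image = nth-ext none (trans T″.length-types (sym length-image)) λ n _ →
      hasType-unique (T″.types-spec n) (decoded-type (s≤s z≤n))

    -- Both lists are normal forms of `map flip image` for the steps of `E`: the left one after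
    -- transporting its steps from `E″`, the right one because flipping reverses the path from
    -- `map flip types` to `image`.
    image-of-image : T″.image ≡ types
    image-of-image = normal-unique reg? both∃? from-image
      (λ s → proj₂ (proj₂ T″.normalised) (step-map (λ a b → proj₁ (Reg-iff a b)) s))
      (subst (Star (Step 1) (map flip image)) flip-flip (flip-steps (proj₁ (proj₂ normalised)))) types-normal
      where
      from-image : Star (Step 1) (map flip image) T″.image
      from-image = subst (λ τ → Star (Step 1) (map flip τ) T″.image) types-of-image
        (Star.map (step-map (λ a b → proj₂ (Reg-iff a b))) (proj₁ (proj₂ T″.normalised)))
      flip-flip : map flip (map flip types) ≡ types
      flip-flip = trans (sym (map-∘ types)) (trans (map-cong flip-involutive types) (map-id types))

    decoded-twice : ∀ {E‴} → T″.Decoded T″.image E‴ → ∀ {a b} → In a b → E‴ a b ≡ E a b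
    decoded-twice {E‴} D′ {a} {b} m = sorted-ext (D′.sorted′ m) (sorted m) agree
      where
      module D = Decoded D
      module D₀ = Decoded types-decoded
      module D′ = T″.Decoded (subst (λ τ → T″.Decoded τ E‴) image-of-image D′)
      agree : ∀ k → k ∈ E‴ a b ⟷ k ∈ E a b
      agree k with class k
      ... | is-i refl =
        (λ p → let r , h = proj₁ (D′.i-spec m) p in proj₂ (D₀.i-spec m) (proj₂ (Reg-iff a b) r , h)) ,
        (λ p → let r , h = proj₁ (D₀.i-spec m) p in proj₂ (D′.i-spec m) (proj₁ (Reg-iff a b) r , h))
      ... | is-j refl =
        (λ p → let r , h = proj₁ (D′.j-spec m) p in proj₂ (D₀.j-spec m) (proj₂ (Reg-iff a b) r , h)) ,
        (λ p → let r , h = proj₁ (D₀.j-spec m) p in proj₂ (D′.j-spec m) (proj₁ (Reg-iff a b) r , h))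
      ... | other n n′ =
        (λ p → proj₂ (D.others m n n′) (proj₂ (D′.others m n n′) p)) ,
        (λ p → proj₁ (D′.others m n n′) (proj₁ (D.others m n n′) p))

  module Of (F : Filling) (v : IsSVRPP la μ F) where
    open Types (entry μ F) (IsSVRPP⇒Valid v) public

    F′ : Filling
    F′ = build (decode image)

    F′-decoded : Decoded image (entry μ F′)
    F′-decoded = decode-decoded image-arranged

    F′-valid : IsSVRPP la μ F′
    F′-valid = Valid⇒IsSVRPP (build-rows (decode image)) (build-rowLen (decode image))
                 (Decoding.valid′ F′-decoded image-arranged)

    module Before = Statistics F types-decoded types-arranged length-types
    module After  = Statistics F′ F′-decoded image-arranged length-image

    ceq-preserved : ∀ a → ceq la μ F′ a ≡ ceq la μ F a
    ceq-preserved a = +-cancelʳ-≡ _ _ _ (begin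
      ceq la μ F′ a + Before.total mixed  ≡⟨ cong (ceq la μ F′ a +_) (sym (total-image _ _ (isMix-flip a (suc a)))) ⟩
      ceq la μ F′ a + After.total mixed   ≡⟨ After.ceq-total a ⟩
      sum (map (eq-const a) (range1 W))   ≡⟨ sym (Before.ceq-total a) ⟩
      ceq la μ F a + Before.total mixed   ∎)
      where
      open ≡-Reasoning
      mixed = ind ∘ isMix a (suc a)

    ex-preserved : ∀ a → ex la μ F′ a ≡ ex la μ F a
    ex-preserved a = trans (After.ex-total a)
      (trans (cong (sum (map (excess-const a) (range1 W)) +_) (total-image _ _ (isMix-flip a a))) (sym (Before.ex-total a)))

    ircont-others : ∀ {k} → k ≢ i → k ≢ suc i → ircont la μ F′ k ≡ ircont la μ F k
    ircont-others {k} n n′ = begin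
      ircont la μ F′ k                                ≡⟨ length-filterᵇ (colHasᵇ la μ F′ k) (range1 W) ⟩
      sum (map (ind ∘ colHasᵇ la μ F′ k) (range1 W))  ≡⟨ cong sum (map-cong (cong ind ∘ same) (range1 W)) ⟩
      sum (map (ind ∘ colHasᵇ la μ F k) (range1 W))   ≡⟨ sym (length-filterᵇ (colHasᵇ la μ F k) (range1 W)) ⟩
      ircont la μ F k                                 ∎
      where
      open ≡-Reasoning
      open Decoded F′-decoded
      same : ∀ b → colHasᵇ la μ F′ k b ≡ colHasᵇ la μ F k b
      same b = T-ext
        ( (λ t → let a , m , p = proj₁ (T-colHasᵇ F′ k b) t in proj₂ (T-colHasᵇ F k b) (a , m , proj₂ (others m n n′) p))
        , (λ t → let a , m , p = proj₁ (T-colHasᵇ F k b) t in proj₂ (T-colHasᵇ F′ k b) (a , m , proj₁ (others m n n′) p)))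

    ircont-swapped : ∀ k → ircont la μ F′ k ≡ ircont la μ F (swapIdx i k)
    -- Matching on the boolean itself makes `swapIdx` compute, and in the false case `≡⇒≡ᵇ` turns
    -- into a proof of `k ≢ i`.
    ircont-swapped k with k ≡ᵇ i | ≡ᵇ⇒≡ k i | ≡⇒≡ᵇ k i
    ... | true | k≡i | _ = begin
      ircont la μ F′ k      ≡⟨ cong (ircont la μ F′) (k≡i tt) ⟩
      ircont la μ F′ i      ≡⟨ After.ircont-i ⟩
      After.total (ind ∘ isI) ≡⟨ total-image isI isJ isI-flip ⟩
      Before.total (ind ∘ isJ) ≡⟨ sym Before.ircont-j ⟩
      ircont la μ F (suc i) ∎
      where open ≡-Reasoning
    ... | false | _ | k≢i with k ≡ᵇ suc i | ≡ᵇ⇒≡ k (suc i) | ≡⇒≡ᵇ k (suc i)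
    ...   | true | k≡j | _ = begin
      ircont la μ F′ k         ≡⟨ cong (ircont la μ F′) (k≡j tt) ⟩
      ircont la μ F′ (suc i)   ≡⟨ After.ircont-j ⟩
      After.total (ind ∘ isJ)  ≡⟨ total-image isJ isI isJ-flip ⟩
      Before.total (ind ∘ isI) ≡⟨ sym Before.ircont-i ⟩
      ircont la μ F i          ∎
      where open ≡-Reasoning
    ...   | false | _ | k≢j = ircont-others k≢i k≢j

  Φ : SVRPP la μ → SVRPP la μ
  Φ (F , v) = Of.F′ F v , Of.F′-valid F v

  Φ-involutive : ∀ T → proj₁ (Φ (Φ T)) ≡ proj₁ T
  Φ-involutive (F , v) = entry-ext (Of.F′-valid _ (Of.F′-valid F v)) v λ a b m →
    Twice.decoded-twice (IsSVRPP⇒Valid v) (IsSVRPP⇒Valid (Of.F′-valid F v)) (Of.F′-decoded F v)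
      (Of.F′-decoded _ (Of.F′-valid F v)) m

theorem2p1 : (λ′ μ : List ℕ) → IsPartition λ′ → IsPartition μ → μ ⊆ₚ λ′ →
    (i : ℕ) → 1 ≤ i →
    Σ (SVRPP λ′ μ → SVRPP λ′ μ) (λ Φ → (∀ T → proj₁ (Φ (Φ T)) ≡ proj₁ T) ×
    (∀ T → (∀ a → ceq λ′ μ (proj₁ (Φ T)) a ≡ ceq λ′ μ (proj₁ T) a) ×
    (∀ a → ex λ′ μ (proj₁ (Φ T)) a ≡ ex λ′ μ (proj₁ T) a) ×
    (∀ k → 1 ≤ k → ircont λ′ μ (proj₁ (Φ T)) k ≡ ircont λ′ μ (proj₁ T) (swapIdx i k))))
theorem2p1 λ′ μ λ-part μ-part _ i i-pos =
  Φ , Φ-involutive , λ { (F , v) → Of.ceq-preserved F v , Of.ex-preserved F v , λ k _ → Of.ircont-swapped F v k }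
  where open BenderKnuth λ′ μ λ-part μ-part i i-pos
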